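{- For a finite simple graph $G$ the following statements are equivalent: (1) $G$ admits a $\{{}^bP_3,{}^rP_3,{}^bK_3,{}^rK_3\}$-free $2$-edge-colouring. (2) Each connected component of $G$ is an induced subgraph of either $K_5$, the diamond, an even cycle, or an $n$-butterfly for some $n\ge 0$. (3) $G$ is a $\{\text{odd-hole}, \text{claw}, \text{house}, \text{bull}, \text{gem}, 4\text{ -wheel}, \text{kite}, X_1, X_2, K_4+l, K_5-e, K_6\}$-free graph.
   Context: Graphs are finite and simple. A $2$-edge-colouring of $G$ assigns to every edge the colour red or blue (not necessarily properly). For a set $\mathcal F$ of $2$-edge-coloured graphs, a $2$-edge-colouring of $G$ is $\mathcal F$-free if no induced $2$-edge-coloured subgraph is isomorphic (preserving colours) to a member of $\mathcal F$. Patterns on three vertices: ${}^rP_3$ (resp. ${}^bP_3$) is the path on three vertices with both edges red (resp. blue); ${}^rK_3$ (resp. ${}^bK_3$) is the triangle with all edges red (resp. blue). For uncoloured graphs, being free of a set of graphs means containing no induced subgraph isomorphic to a member. Claw: $K_{1,3}$. Diamond: $K_4$ minus an edge. House: $C_4$ plus a new vertex adjacent to exactly two adjacent vertices of the $C_4$. Bull: a triangle plus two new non-adjacent vertices, each adjacent to exactly one vertex of the triangle, these two triangle vertices being distinct. $4$-wheel: join of $C_4$ and $K_1$. Gem: join of $P_4$ and $K_1$. Kite: diamond plus a new vertex adjacent to exactly one vertex of the diamond, which has degree $2$ in the diamond. $X_1$: diamond plus a new vertex adjacent to exactly the two vertices of degree $2$ of the diamond. $X_2$: diamond plus a new vertex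 adjacent to both vertices of degree $3$ and to exactly one vertex of degree $2$ of the diamond. $K_4+l$: $K_4$ plus a new vertex adjacent to exactly one vertex of the $K_4$. $K_5-e$: $K_5$ minus one edge. An odd-hole is a chordless cycle of odd length at least $5$; an even cycle is a cycle $C_{2m}$ with $m\ge 2$. For $n\ge 0$, the $n$-butterfly consists of two triangles joined by a path of length $n$ (one vertex of each triangle is an end of the path; for $n=0$ the two triangles share exactly one vertex). -}

module Defs where

open import Data.Bool using (Bool; true; false; T; not; _∧_; _∨_)
open import Data.Bool.ListAction using (any)
open import Data.Bool.Properties using (∨-comm)
open import Data.Fin using (Fin; toℕ; _≟_)
open import Data.Fin.Subset using (Subset; _∈_)
open import Data.List using (List; []; _∷_; _++_)
open import Data.Nat using (ℕ; suc; _+_; _*_; _≤_; _≡ᵇ_)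
open import Data.Product using (_×_; _,_; proj₁; Σ-syntax; ∃-syntax)
open import Data.Sum using (_⊎_)
open import Function.Bundles using (_⇔_; mk⇔)
open import Function.Definitions using (Injective)
open import Relation.Binary.Construct.Closure.ReflexiveTransitive using (Star)
open import Relation.Binary.PropositionalEquality using (_≡_; refl; sym; cong; cong₂)
open import Relation.Nullary using (¬_; does)
open import Relation.Nullary.Decidable using (dec-true; does-⇔)

-- A simple graph with vertex set V; the finite graphs are those on Fin n and
-- their induced subgraphs.
record Graph (V : Set) : Set where
  field
    adj        : V → V → Bool
    adj-sym    : ∀ u v → adj u v ≡ adj v u
    adj-irrefl : ∀ v → adj v v ≡ false

  infix 4 _~_
  _~_ : V → V → Set
  u ~ v = T (adj u v)

open Graph public using (adj)

-- An embedding f is exactly an isomorphism from H onto the subgraph of G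
-- induced by the image of f.
record InducedEmbedding {V W : Set} (H : Graph V) (G : Graph W) : Set where
  field
    to        : V → W
    injective : Injective _≡_ _≡_ to
    adj-≡     : ∀ u v → adj G (to u) (to v) ≡ adj H u v

infix 4 _⊑_
_⊑_ : {V W : Set} → Graph V → Graph W → Set
H ⊑ G = InducedEmbedding H G

infix 8 _[_]
_[_] : ∀ {n} → Graph (Fin n) → (S : Subset n) → Graph (Σ[ v ∈ Fin n ] v ∈ S)
G [ S ] = record
  { adj        = λ u v → adj G (proj₁ u) (proj₁ v)
  ; adj-sym    = λ u v → Graph.adj-sym G (proj₁ u) (proj₁ v)
  ; adj-irrefl = λ v → Graph.adj-irrefl G (proj₁ v)
  }

IsComponent : ∀ {n} → Graph (Fin n) → Subset n → Set
IsComponent {n} G S = ∃[ v ] (∀ u → u ∈ S ⇔ Star (Graph._~_ G) v u)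

GraphFamily : Set₁
GraphFamily = ∀ {k} → Graph (Fin k) → Set

_-Free : GraphFamily → ∀ {n} → Graph (Fin n) → Set
(𝓕 -Free) G = ∀ {k} {H : Graph (Fin k)} → 𝓕 H → ¬ (H ⊑ G)

------------------------------------------------------------------------
-- Edge colourings

data Colour : Set where
  red blue : Colour

-- Since u ~ v has at most one proof, colour-sym only says that an edge has the
-- same colour in both directions.
record EdgeColouring {V : Set} (G : Graph V) : Set where
  open Graph G using (_~_)
  field
    colour     : ∀ u v → u ~ v → Colour
    colour-sym : ∀ u v (e : u ~ v) (e′ : v ~ u) → colour u v e ≡ colour v u e′

open EdgeColouring public using (colour)

record ColouredEmbedding {V W : Set} {H : Graph V} {G : Graph W}
                         (d : EdgeColouring H) (c : EdgeColouring G) : Set where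
  field
    embedding : InducedEmbedding H G
  open InducedEmbedding embedding public
  open Graph H using () renaming (_~_ to _~ᴴ_)
  open Graph G using () renaming (_~_ to _~ᴳ_)
  field
    colour-≡ : ∀ u v (e : u ~ᴴ v) (e′ : to u ~ᴳ to v) →
               colour c (to u) (to v) e′ ≡ colour d u v e

ColouredFamily : Set₁
ColouredFamily = ∀ {k} {H : Graph (Fin k)} → EdgeColouring H → Set

_-FreeColouring : ColouredFamily → ∀ {n} {G : Graph (Fin n)} → EdgeColouring G → Set
(𝓕 -FreeColouring) c =
  ∀ {k} {H : Graph (Fin k)} {d : EdgeColouring H} → 𝓕 d → ¬ ColouredEmbedding d c

monochromatic : {V : Set} → Colour → (G : Graph V) → EdgeColouring G
monochromatic x G = record
  { colour     = λ _ _ _ → x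
  ; colour-sym = λ _ _ _ _ → refl
  }

------------------------------------------------------------------------
-- Concrete graphs

-- The symmetric, loopless closure of r.
fromRel : ∀ {n} → (Fin n → Fin n → Bool) → Graph (Fin n)
fromRel r = record
  { adj        = λ u v → not (does (u ≟ v)) ∧ (r u v ∨ r v u)
  ; adj-sym    = λ u v → cong₂ (λ x y → not x ∧ y)
                               (does-⇔ (mk⇔ sym sym) (u ≟ v) (v ≟ u))
                               (∨-comm (r u v) (r v u))
  ; adj-irrefl = λ v → cong (λ x → not x ∧ (r v v ∨ r v v)) (dec-true (v ≟ v) refl)
  }

Edges : Set
Edges = List (ℕ × ℕ)

fromEdges : (n : ℕ) → Edges → Graph (Fin n)
fromEdges n es = fromRel λ u v → any (λ (a , b) → (toℕ u ≡ᵇ a) ∧ (toℕ v ≡ᵇ b)) es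

complete : (n : ℕ) → Graph (Fin n)
complete n = fromRel λ _ _ → true

-- The cycle C_n when 3 ≤ n.
cycle : (n : ℕ) → Graph (Fin n)
cycle n = fromRel λ u v → (suc (toℕ u) ≡ᵇ toℕ v)
                        ∨ ((toℕ u ≡ᵇ 0) ∧ (suc (toℕ v) ≡ᵇ n))

-- The path 0, 1, …, n + 4 with the chords {0, 2} and {n + 2, n + 4}: the
-- triangles are {0, 1, 2} and {n + 2, n + 3, n + 4}, joined by the path
-- 2, …, n + 2.
butterfly : (n : ℕ) → Graph (Fin (5 + n))
butterfly n = fromRel λ u v → (suc (toℕ u) ≡ᵇ toℕ v)
                            ∨ ((toℕ u ≡ᵇ 0) ∧ (toℕ v ≡ᵇ 2))
                            ∨ ((toℕ u ≡ᵇ 2 + n) ∧ (toℕ v ≡ᵇ 4 + n))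

C₄-edges : Edges
C₄-edges = (0 , 1) ∷ (1 , 2) ∷ (2 , 3) ∷ (3 , 0) ∷ []

K₄-edges : Edges
K₄-edges = (0 , 1) ∷ (0 , 2) ∷ (0 , 3) ∷ (1 , 2) ∷ (1 , 3) ∷ (2 , 3) ∷ []

-- 0 and 1 have degree 3; 2 and 3 have degree 2.
diamond-edges : Edges
diamond-edges = (0 , 1) ∷ (0 , 2) ∷ (0 , 3) ∷ (1 , 2) ∷ (1 , 3) ∷ []

P₃ : Graph (Fin 3)
P₃ = fromEdges 3 ((0 , 1) ∷ (1 , 2) ∷ [])

claw : Graph (Fin 4)
claw = fromEdges 4 ((0 , 1) ∷ (0 , 2) ∷ (0 , 3) ∷ [])

diamond : Graph (Fin 4)
diamond = fromEdges 4 diamond-edges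

house : Graph (Fin 5)
house = fromEdges 5 (C₄-edges ++ (4 , 0) ∷ (4 , 1) ∷ [])

bull : Graph (Fin 5)
bull = fromEdges 5 ((0 , 1) ∷ (1 , 2) ∷ (2 , 0) ∷ (3 , 0) ∷ (4 , 1) ∷ [])

gem : Graph (Fin 5)
gem = fromEdges 5 ((0 , 1) ∷ (1 , 2) ∷ (2 , 3) ∷
                   (4 , 0) ∷ (4 , 1) ∷ (4 , 2) ∷ (4 , 3) ∷ [])

4-wheel : Graph (Fin 5)
4-wheel = fromEdges 5 (C₄-edges ++ (4 , 0) ∷ (4 , 1) ∷ (4 , 2) ∷ (4 , 3) ∷ [])

kite : Graph (Fin 5)
kite = fromEdges 5 (diamond-edges ++ (4 , 2) ∷ [])

X₁ : Graph (Fin 5)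
X₁ = fromEdges 5 (diamond-edges ++ (4 , 2) ∷ (4 , 3) ∷ [])

X₂ : Graph (Fin 5)
X₂ = fromEdges 5 (diamond-edges ++ (4 , 0) ∷ (4 , 1) ∷ (4 , 2) ∷ [])

K₄+l : Graph (Fin 5)
K₄+l = fromEdges 5 (K₄-edges ++ (4 , 0) ∷ [])

-- The missing edge is {3, 4}.
K₅-e : Graph (Fin 5)
K₅-e = fromEdges 5 (K₄-edges ++ (4 , 0) ∷ (4 , 1) ∷ (4 , 2) ∷ [])

------------------------------------------------------------------------
-- The families and the three conditions

data MonochromaticP₃K₃ : ColouredFamily where
  ᵇP₃ : MonochromaticP₃K₃ (monochromatic blue P₃)
  ʳP₃ : MonochromaticP₃K₃ (monochromatic red P₃)
  ᵇK₃ : MonochromaticP₃K₃ (monochromatic blue (complete 3))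
  ʳK₃ : MonochromaticP₃K₃ (monochromatic red (complete 3))

data Forbidden : GraphFamily where
  odd-holeᶠ : ∀ m → 2 ≤ m → Forbidden (cycle (2 * m + 1))
  clawᶠ     : Forbidden claw
  houseᶠ    : Forbidden house
  bullᶠ     : Forbidden bull
  gemᶠ      : Forbidden gem
  4-wheelᶠ  : Forbidden 4-wheel
  kiteᶠ     : Forbidden kite
  X₁ᶠ       : Forbidden X₁
  X₂ᶠ       : Forbidden X₂
  K₄+lᶠ     : Forbidden K₄+l
  K₅-eᶠ     : Forbidden K₅-e
  K₆ᶠ       : Forbidden (complete 6)

HasFreeColouring : ColouredFamily → ∀ {n} → Graph (Fin n) → Set
HasFreeColouring 𝓕 G = ∃[ c ] (𝓕 -FreeColouring) {G = G} c

ComponentType : {V : Set} → Graph V → Set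
ComponentType H = (H ⊑ complete 5)
                ⊎ (H ⊑ diamond)
                ⊎ (∃[ m ] (2 ≤ m × H ⊑ cycle (2 * m)))
                ⊎ (∃[ n ] (H ⊑ butterfly n))

AllComponents : ∀ {n} → ({V : Set} → Graph V → Set) → Graph (Fin n) → Set
AllComponents P G = ∀ S → IsComponent G S → P (G [ S ])

{-# OPTIONS --safe #-}

-- Call a colouring good if a walk u, v, w with edges of equal colour always closes up to a
-- triangle whose third edge has the other colour.  Good colourings restrict to induced
-- subgraphs, and none of the forbidden graphs has one: along an odd hole the colours would
-- have to alternate, and the other graphs are small enough for exhaustive search.
--
-- Conversely let G be connected without forbidden subgraphs.  A diamond, K₅ or (failing these)
-- K₄ in G is all of G, because every other pattern of attaching one more vertex contains a
-- forbidden graph.  In their absence, only one vertex of a triangle has neighbours outside it,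
-- and claw-freeness forces a unique way to continue from there: along a path, which stops or
-- ends in a second triangle, so that G lies in a butterfly.  The same walk starts at a vertex
-- of degree one; otherwise G is a cycle, of even length since there are no odd holes.
--
-- Finally each component type has a good colouring, built by adding one vertex at a time.
module Submission where

open import Defs
open import Data.Bool using (Bool; true; false; T; not; _∧_; _∨_; if_then_else_)
import Data.Bool.Properties as Bool
open import Data.Empty using (⊥; ⊥-elim)
open import Data.Fin using (Fin; zero; suc; toℕ)
open import Data.Fin.Patterns using (0F; 1F; 2F; 3F)
import Data.Fin.Properties as Fin
open import Data.Fin.Subset using (Subset; _∈_)
open import Data.Fin.Subset.Properties using (_∈?_)
open import Data.List using (List; []; _∷_; filterᵇ; cartesianProduct; allFin)
import Data.List.Membership.DecPropositional as DecMembership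
open import Data.List.Membership.Propositional using () renaming (_∈_ to _∈ˡ_)
open import Data.List.Membership.Propositional.Properties using (∈-cartesianProduct⁺; ∈-allFin)
import Data.List.Relation.Unary.All as All
open import Data.List.Relation.Unary.All using (All; []; _∷_)
open import Data.List.Relation.Unary.All.Properties using (All¬⇒¬Any)
import Data.List.Relation.Unary.Any as Any
open import Data.List.Relation.Unary.Any using (Any; here; there)
open import Data.Nat using (ℕ; zero; suc; _≤_; s≤s; z≤n; _+_; _*_; _≡ᵇ_; _<ᵇ_)
import Data.Nat.Properties as Nat
open import Data.Product using (_×_; _,_; proj₁; proj₂; ∃; Σ-syntax; ∃-syntax)
import Data.Product.Properties as Prod
open import Data.Sum using (_⊎_; inj₁; inj₂)
open import Data.Unit using (⊤; tt)
open import Data.Vec using (Vec; []; _∷_; lookup; tabulate)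
open import Data.Vec.Properties using (lookup∘tabulate; []=⇒lookup; lookup⇒[]=)
open import Data.Vec.Properties.WithK using ([]=-irrelevant)
open import Function using (_∘_; Equivalence; mk⇔)
open import Function.Bundles using (_⇔_)
open import Function.Definitions using (Injective)
open import Relation.Binary using (DecidableEquality)
open import Relation.Binary.Construct.Closure.ReflexiveTransitive
  using (Star; ε; _◅_; _◅◅_; reverse)
open import Relation.Binary.PropositionalEquality
  using (_≡_; _≢_; refl; sym; trans; cong; cong₂; subst)
open import Relation.Nullary using (¬_; Dec; does; yes; no)
open import Relation.Nullary.Decidable
  using (map′; _×-dec_; _⊎-dec_; _→-dec_; ¬?; from-yes; decidable-stable; dec-true)
open import Relation.Unary using (Decidable)

open InducedEmbedding

private variable
  k l n : ℕ
  V W X : Set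

-- Embeddings

T⇒≡true : ∀ {b} → T b → b ≡ true
T⇒≡true {true} _ = refl

¬T⇒≡false : ∀ {b} → ¬ T b → b ≡ false
¬T⇒≡false {true}  ¬b = ⊥-elim (¬b tt)
¬T⇒≡false {false} _  = refl

≡false⇒¬T : ∀ {b} → b ≡ false → ¬ T b
≡false⇒¬T refl ()

symmetric : (G : Graph V) → ∀ {u v} → T (adj G u v) → T (adj G v u)
symmetric G {u} {v} = subst T (Graph.adj-sym G u v)

~⇒≢ : (G : Graph V) → ∀ {u v} → T (adj G u v) → u ≢ v
~⇒≢ G {u} e refl = subst T (Graph.adj-irrefl G u) e

⊑-trans : {F : Graph V} {H : Graph W} {G : Graph X} → F ⊑ H → H ⊑ G → F ⊑ G
⊑-trans f g = record
  { to        = to g ∘ to f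
  ; injective = injective f ∘ injective g
  ; adj-≡     = λ u v → trans (adj-≡ g _ _) (adj-≡ f u v)
  }

≗⇒⊑ : {H G : Graph V} → (∀ u v → adj G u v ≡ adj H u v) → H ⊑ G
≗⇒⊑ eq = record { to = λ v → v ; injective = λ e → e ; adj-≡ = eq }

≗⇒⊒ : {H G : Graph V} → (∀ u v → adj G u v ≡ adj H u v) → G ⊑ H
≗⇒⊒ eq = ≗⇒⊑ λ u v → sym (eq u v)

⊑-refl : {G : Graph V} → G ⊑ G
⊑-refl = ≗⇒⊑ λ _ _ → refl

edge : {H : Graph V} {G : Graph W} (f : H ⊑ G) → ∀ {u v} →
       T (adj H u v) → T (adj G (to f u) (to f v))
edge f {u} {v} = subst T (sym (adj-≡ f u v))

edge⁻¹ : {H : Graph V} {G : Graph W} (f : H ⊑ G) → ∀ {u v} →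
         T (adj G (to f u) (to f v)) → T (adj H u v)
edge⁻¹ f {u} {v} = subst T (adj-≡ f u v)

tail : Graph (Fin (suc k)) → Graph (Fin k)
tail H = record
  { adj        = λ u v → adj H (suc u) (suc v)
  ; adj-sym    = λ u v → Graph.adj-sym H (suc u) (suc v)
  ; adj-irrefl = λ v → Graph.adj-irrefl H (suc v)
  }

tail-⊑ : (H : Graph (Fin (suc k))) → tail H ⊑ H
tail-⊑ H = record { to = suc ; injective = Fin.suc-injective ; adj-≡ = λ _ _ → refl }

-- b ▹ H is H, with its vertices shifted by suc, and a new vertex zero whose
-- neighbours are given by b.
infixr 5 _▹_
_▹_ : (Fin k → Bool) → Graph (Fin k) → Graph (Fin (suc k))
_▹_ {k} b H = record { adj = a ; adj-sym = a-sym ; adj-irrefl = a-irrefl }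
  where
  a : Fin (suc k) → Fin (suc k) → Bool
  a zero    zero    = false
  a zero    (suc v) = b v
  a (suc u) zero    = b u
  a (suc u) (suc v) = adj H u v

  a-sym : ∀ u v → a u v ≡ a v u
  a-sym zero    zero    = refl
  a-sym zero    (suc v) = refl
  a-sym (suc u) zero    = refl
  a-sym (suc u) (suc v) = Graph.adj-sym H u v

  a-irrefl : ∀ v → a v v ≡ false
  a-irrefl zero    = refl
  a-irrefl (suc v) = Graph.adj-irrefl H v

nothing : {H : Graph (Fin 0)} {G : Graph V} → H ⊑ G
nothing = record { to = λ () ; injective = λ { {()} } ; adj-≡ = λ () }

-- Embeddings are built by adding vertex zero last. Symmetry and irreflexivity of both graphs reduce
-- the new obligations to the row of zero.
extend : {G : Graph V} (H : Graph (Fin (suc k))) (f : tail H ⊑ G) (y : V) →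
         (∀ i → to f i ≢ y) → (∀ i → adj G y (to f i) ≡ adj H zero (suc i)) → H ⊑ G
extend {V} {k} {G} H f y new eq = record { to = g ; injective = inj ; adj-≡ = g-adj }
  where
  g : Fin (suc k) → V
  g zero    = y
  g (suc i) = to f i

  inj : Injective _≡_ _≡_ g
  inj {zero}  {zero}  _ = refl
  inj {zero}  {suc j} e = ⊥-elim (new j (sym e))
  inj {suc i} {zero}  e = ⊥-elim (new i e)
  inj {suc i} {suc j} e = cong suc (injective f e)

  g-adj : ∀ i j → adj G (g i) (g j) ≡ adj H i j
  g-adj zero    zero    = trans (Graph.adj-irrefl G y) (sym (Graph.adj-irrefl H zero))
  g-adj zero    (suc j) = eq j
  g-adj (suc i) zero    = trans (Graph.adj-sym G _ _)
                                (trans (eq i) (Graph.adj-sym H zero (suc i)))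
  g-adj (suc i) (suc j) = adj-≡ f i j

▹-mono : {H : Graph (Fin k)} {K : Graph (Fin l)} {b : Fin k → Bool} {c : Fin l → Bool}
         (f : H ⊑ K) → (∀ i → c (to f i) ≡ b i) → b ▹ H ⊑ c ▹ K
▹-mono {K = K} {c = c} f eq =
  extend _ (⊑-trans f (tail-⊑ (c ▹ K))) zero (λ i ()) eq

vertex : {G : Graph V} → V → complete 1 ⊑ G
vertex v = extend _ nothing v (λ ()) (λ ())

tail-complete : ∀ n → tail (complete (suc n)) ⊑ complete n
tail-complete n = ≗⇒⊑ λ _ _ → refl

pair : {G : Graph V} → ∀ {u v} → T (adj G u v) → complete 2 ⊑ G
pair {G = G} {u} {v} e =
  extend _ (⊑-trans (tail-complete 1) (vertex v)) u
    (λ { zero p → ~⇒≢ G e (sym p) })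
    (λ { zero → T⇒≡true e })

triangle : {G : Graph V} → ∀ {u v w} → T (adj G u v) → T (adj G u w) → T (adj G v w) →
           complete 3 ⊑ G
triangle {G = G} {u} {v} {w} uv uw vw = extend _ (⊑-trans (tail-complete 2) (pair vw)) u
  (λ { zero p → ~⇒≢ G uv (sym p) ; (suc zero) p → ~⇒≢ G uw (sym p) })
  (λ { zero → T⇒≡true uv ; (suc zero) → T⇒≡true uw })

-- Deciding embeddability

-- Covers both `Fin n` and the vertex set of an induced subgraph, whose elements carry membership
-- proofs. For the latter only an upper bound on the cardinality is at hand; it serves as fuel for
-- the walks below.
record Finite (V : Set) : Set₁ where
  field
    _≟_   : DecidableEquality V
    any?  : {P : V → Set} → (∀ v → Dec (P v)) → Dec (∃ P)
    size  : ℕ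
    bound : {f : Fin k → V} → Injective _≡_ _≡_ f → k ≤ size

Fin-finite : Finite (Fin n)
Fin-finite {n} = record
  { _≟_ = Fin._≟_ ; any? = Fin.any? ; size = n ; bound = Fin.injective⇒≤ }

Extends : Graph V → Graph (Fin (suc k)) → V → Vec V k → Set
Extends G H x xs = ∀ i → lookup xs i ≢ x × adj G x (lookup xs i) ≡ adj H zero (suc i)

Embeds : (H : Graph (Fin k)) → Graph V → Vec V k → Set
Embeds H G []       = ⊤
Embeds H G (x ∷ xs) = Embeds (tail H) G xs × Extends G H x xs

-- Quantifying x after xs makes the search backtrack as soon as a partial
-- embedding fails.
search : Finite V → (H : Graph (Fin k)) (G : Graph V) {P : Vec V k → Set} →
         Decidable P → Dec (∃[ xs ] (Embeds H G xs × P xs))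
search {k = zero} fin H G P? =
  map′ (λ p → [] , tt , p) (λ { ([] , _ , p) → p }) (P? [])
search {k = suc k} fin H G P? =
  map′ (λ (xs , e , x , h , p) → x ∷ xs , (e , h) , p)
       (λ { (x ∷ xs , (e , h) , p) → xs , e , x , h , p })
       (search fin (tail H) G λ xs → Finite.any? fin λ x →
         Fin.all? (λ i → ¬? (Finite._≟_ fin (lookup xs i) x)
                         ×-dec (adj G x (lookup xs i) Bool.≟ adj H zero (suc i)))
         ×-dec P? (x ∷ xs))

Embeds⇒⊑ : (H : Graph (Fin k)) (G : Graph V) (xs : Vec V k) → Embeds H G xs →
           Σ[ f ∈ H ⊑ G ] (∀ i → to f i ≡ lookup xs i)
Embeds⇒⊑ H G []       _       = nothing , λ ()
Embeds⇒⊑ H G (x ∷ xs) (e , h) with f , f≗ ← Embeds⇒⊑ (tail H) G xs e =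
    extend H f x (λ i p → proj₁ (h i) (trans (sym (f≗ i)) p))
                 (λ i → trans (cong (adj G x) (f≗ i)) (proj₂ (h i)))
  , λ { zero → refl ; (suc i) → f≗ i }

⊑⇒Embeds : (H : Graph (Fin k)) (G : Graph V) (f : H ⊑ G) → Embeds H G (tabulate (to f))
⊑⇒Embeds {k = zero}  H G f = tt
⊑⇒Embeds {k = suc k} H G f = ⊑⇒Embeds (tail H) G (⊑-trans (tail-⊑ H) f) , h
  where
  h : Extends G H (to f zero) (tabulate (to f ∘ suc))
  h i rewrite lookup∘tabulate (to f ∘ suc) i =
    (λ e → Fin.0≢1+n (sym (injective f e))) , adj-≡ f zero (suc i)

embeds? : Finite V → (H : Graph (Fin k)) (G : Graph V) → Dec (H ⊑ G)
embeds? fin H G =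
  map′ (λ (xs , e , _) → proj₁ (Embeds⇒⊑ H G xs e))
       (λ f → tabulate (to f) , ⊑⇒Embeds H G f , tt)
       (search fin H G {P = λ _ → ⊤} λ _ → yes tt)

FiniteGraph : Set
FiniteGraph = ∃[ k ] Graph (Fin k)

Contains : List FiniteGraph → Graph V → Set
Contains Fs G = Any (λ (_ , F) → F ⊑ G) Fs

contains? : Finite V → (Fs : List FiniteGraph) (G : Graph V) → Dec (Contains Fs G)
contains? fin Fs G = Any.any? (λ (_ , F) → embeds? fin F G) Fs

Contains-mono : {Fs : List FiniteGraph} {H : Graph V} {G : Graph W} →
                H ⊑ G → Contains Fs H → Contains Fs G
Contains-mono f = Any.map λ g → ⊑-trans g f

∀Vec? : {Q : Vec Bool k → Set} → Decidable Q → Dec (∀ p → Q p)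
∀Vec? {k = zero}  Q? = map′ (λ { q [] → q }) (λ q → q []) (Q? [])
∀Vec? {k = suc k} Q? =
  map′ (λ { (q , r) (true ∷ p) → q p ; (q , r) (false ∷ p) → r p })
       (λ q → (λ p → q (true ∷ p)) , (λ p → q (false ∷ p)))
       (∀Vec? (λ p → Q? (true ∷ p)) ×-dec ∀Vec? (λ p → Q? (false ∷ p)))

-- Attaching vertices to small graphs, checked exhaustively

small : List FiniteGraph
small = (_ , claw) ∷ (_ , house) ∷ (_ , bull) ∷ (_ , gem) ∷ (_ , 4-wheel) ∷ (_ , kite)
      ∷ (_ , X₁) ∷ (_ , X₂) ∷ (_ , K₄+l) ∷ (_ , K₅-e) ∷ (_ , complete 6) ∷ []

small-forbidden : All (λ (_ , F) → Forbidden F) small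
small-forbidden = clawᶠ ∷ houseᶠ ∷ bullᶠ ∷ gemᶠ ∷ 4-wheelᶠ ∷ kiteᶠ
                ∷ X₁ᶠ ∷ X₂ᶠ ∷ K₄+lᶠ ∷ K₅-eᶠ ∷ K₆ᶠ ∷ []

Isolated : Vec Bool k → Set
Isolated p = ∀ i → lookup p i ≡ false

isolated? : Decidable (Isolated {k})
isolated? p = Fin.all? λ i → lookup p i Bool.≟ false

-- In a connected graph avoiding `Fs`, a copy of such an `H` is everything: otherwise some outside
-- vertex would be adjacent to the copy, and its attachment pattern would create a member of `Fs`.
Saturated : List FiniteGraph → Graph (Fin k) → Set
Saturated Fs H = ∀ p → Isolated p ⊎ Contains Fs (lookup p ▹ H)

saturated? : (Fs : List FiniteGraph) (H : Graph (Fin k)) → Dec (Saturated Fs H)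
saturated? Fs H = ∀Vec? λ p → isolated? p ⊎-dec contains? Fin-finite Fs (lookup p ▹ H)

triangle-small : List FiniteGraph
triangle-small = (_ , diamond) ∷ (_ , complete 4) ∷ small

AtMostOne : Vec Bool k → Set
AtMostOne p = ∀ i j → T (lookup p i) → T (lookup p j) → i ≡ j

-- Each search is evaluated once here; `abstract` prevents its evidence from being unfolded by later
-- uses.
abstract
  -- One neighbour on the diamond gives a kite (degree 2) or a claw (degree 3). Two give `X₁` (both
  -- of degree 2), a claw (both of degree 3) or a gem (one of each). Three give a 4-wheel or `X₂`,
  -- and four give `K₅-e`.
  diamond-saturated : Saturated small diamond
  diamond-saturated = from-yes (saturated? small diamond)

  -- One or two neighbours give `K₄+l`, three or four give `K₅-e`, five give K₆.
  K₅-saturated : Saturated small (complete 5)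
  K₅-saturated = from-yes (saturated? small (complete 5))

  -- One neighbour gives `K₄+l`, two give `X₂`, three give `K₅-e`. The fourth case is K₅, hence its
  -- addition to the list.
  K₄-saturated : Saturated ((_ , complete 5) ∷ small) (complete 4)
  K₄-saturated = from-yes (saturated? ((_ , complete 5) ∷ small) (complete 4))

  -- Two neighbours on a triangle give a diamond, three give K₄.
  triangle-neighbour : ∀ p → AtMostOne p ⊎ Contains triangle-small (lookup p ▹ complete 3)
  triangle-neighbour = from-yes (∀Vec? λ p →
    Fin.all? (λ i → Fin.all? λ j →
      Bool.T? (lookup p i) →-dec (Bool.T? (lookup p j) →-dec (i Fin.≟ j)))
    ⊎-dec contains? Fin-finite triangle-small (lookup p ▹ complete 3))

  -- Two vertices attached at different corners of a triangle give a house if they are adjacent and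
  -- a bull if not, unless one of them has several neighbours on the triangle. The entry of `q` at
  -- zero is the adjacency of the two attached vertices, hence the shift to `suc j`.
  triangle-neighbours : ∀ p q →
    (∀ i j → T (lookup p i) → T (lookup q (suc j)) → i ≡ j)
    ⊎ Contains triangle-small (lookup q ▹ lookup p ▹ complete 3)
  triangle-neighbours = from-yes (∀Vec? λ p → ∀Vec? λ q →
    Fin.all? (λ i → Fin.all? λ j →
      Bool.T? (lookup p i) →-dec (Bool.T? (lookup q (suc j)) →-dec (i Fin.≟ j)))
    ⊎-dec contains? Fin-finite triangle-small (lookup q ▹ lookup p ▹ complete 3))

-- Not-all-equal colourings

infix 4 _≟ᶜ_
_≟ᶜ_ : DecidableEquality Colour
red  ≟ᶜ red  = yes refl
red  ≟ᶜ blue = no λ ()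
blue ≟ᶜ red  = no λ ()
blue ≟ᶜ blue = yes refl

opposite : Colour → Colour
opposite red  = blue
opposite blue = red

opposite-involutive : ∀ x → opposite (opposite x) ≡ x
opposite-involutive red  = refl
opposite-involutive blue = refl

opposite-≢ : ∀ x → opposite x ≢ x
opposite-≢ red  ()
opposite-≢ blue ()

≢⇒≡opposite : ∀ {x y} → x ≢ y → x ≡ opposite y
≢⇒≡opposite {red}  {red}  x≢y = ⊥-elim (x≢y refl)
≢⇒≡opposite {red}  {blue} _   = refl
≢⇒≡opposite {blue} {red}  _   = refl
≢⇒≡opposite {blue} {blue} x≢y = ⊥-elim (x≢y refl)

-- This one condition excludes all four patterns.
NotAllEqual : (G : Graph V) → (V → V → Colour) → Set
NotAllEqual G κ = ∀ u v w → u ≢ w → T (adj G u v) → T (adj G v w) →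
                  κ u v ≡ κ v w → T (adj G u w) × κ u w ≢ κ u v

record GoodColouring (G : Graph V) : Set where
  field
    κ             : V → V → Colour
    κ-sym         : ∀ u v → T (adj G u v) → κ u v ≡ κ v u
    not-all-equal : NotAllEqual G κ

  nonadjacent : ∀ {u v w} → u ≢ w → ¬ T (adj G u w) → T (adj G u v) → T (adj G v w) →
                κ u v ≢ κ v w
  nonadjacent u≢w ¬uw uv vw eq = ¬uw (proj₁ (not-all-equal _ _ _ u≢w uv vw eq))

open GoodColouring

pullback : {H : Graph V} {G : Graph W} → H ⊑ G → GoodColouring G → GoodColouring H
pullback f C = record
  { κ             = λ u v → κ C (to f u) (to f v)
  ; κ-sym         = λ u v e → κ-sym C _ _ (edge f e)
  ; not-all-equal = λ u v w u≢w uv vw eq →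
      let uw , ne = not-all-equal C _ _ _ (u≢w ∘ injective f) (edge f uv) (edge f vw) eq
      in edge⁻¹ f uw , ne
  }

module _ {G : Graph (Fin n)} (c : EdgeColouring G)
         (free : (MonochromaticP₃K₃ -FreeColouring) c) where

  -- Turns a colour that depends on an edge proof into a function on pairs. The conditions of
  -- `GoodColouring` concern edges only, so red may be chosen for the other pairs.
  hue : Fin n → Fin n → Colour
  hue u v with Bool.T? (adj G u v)
  ... | yes e = colour c u v e
  ... | no  _ = red

  hue-≡ : ∀ {u v} (e : T (adj G u v)) → colour c u v e ≡ hue u v
  hue-≡ {u} {v} e with Bool.T? (adj G u v)
  ... | yes e′ = cong (colour c u v) (Bool.T-irrelevant e e′)
  ... | no ¬e  = ⊥-elim (¬e e)

  hue-sym : ∀ u v → T (adj G u v) → hue u v ≡ hue v u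
  hue-sym u v e = trans (sym (hue-≡ e))
    (trans (EdgeColouring.colour-sym c u v e (symmetric G e)) (hue-≡ (symmetric G e)))

  mono-embedding : (F : Graph (Fin k)) (f : F ⊑ G) (x : Colour) →
                   (∀ i j → T (adj F i j) → hue (to f i) (to f j) ≡ x) →
                   ColouredEmbedding (monochromatic x F) c
  mono-embedding F f x h = record
    { embedding = f ; colour-≡ = λ i j e e′ → trans (hue-≡ e′) (h i j e) }

  no-P₃ : ∀ x → ¬ ColouredEmbedding (monochromatic x P₃) c
  no-P₃ red  = free ʳP₃
  no-P₃ blue = free ᵇP₃

  no-K₃ : ∀ x → ¬ ColouredEmbedding (monochromatic x (complete 3)) c
  no-K₃ red  = free ʳK₃
  no-K₃ blue = free ᵇK₃

  -- A missing third edge would make the walk a monochromatic P₃, a third edge of the same colour a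
  -- monochromatic K₃.
  hue-not-all-equal : NotAllEqual G hue
  hue-not-all-equal u v w u≢w uv vw eq = close (Bool.T? (adj G u w))
    where
    P₃-embedding : ¬ T (adj G u w) → P₃ ⊑ G
    P₃-embedding ¬uw = extend P₃
      (⊑-trans (≗⇒⊑ λ { zero zero → refl ; zero (suc zero) → refl
                      ; (suc zero) zero → refl ; (suc zero) (suc zero) → refl })
               (pair vw)) u
      (λ { zero p → ~⇒≢ G uv (sym p) ; (suc zero) p → u≢w (sym p) })
      (λ { zero → T⇒≡true uv ; (suc zero) → ¬T⇒≡false ¬uw })

    close : Dec (T (adj G u w)) → T (adj G u w) × hue u w ≢ hue u v
    close (yes uw) = uw , λ eq′ →
      no-K₃ (hue u v) (mono-embedding (complete 3) (triangle uv uw vw) (hue u v) λ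
        { zero             (suc zero)       _ → refl
        ; zero             (suc (suc zero)) _ → eq′
        ; (suc zero)       zero             _ → sym (hue-sym u v uv)
        ; (suc zero)       (suc (suc zero)) _ → sym eq
        ; (suc (suc zero)) zero             _ → trans (sym (hue-sym u w uw)) eq′
        ; (suc (suc zero)) (suc zero)       _ → trans (sym (hue-sym v w vw)) (sym eq)
        ; (suc (suc zero)) (suc (suc zero)) ()
        })
    close (no ¬uw) =
      ⊥-elim (no-P₃ (hue u v) (mono-embedding P₃ (P₃-embedding ¬uw) (hue u v) λ
        { zero             (suc zero)       _ → refl
        ; (suc zero)       zero             _ → sym (hue-sym u v uv)
        ; (suc zero)       (suc (suc zero)) _ → sym eq
        ; (suc (suc zero)) (suc zero)       _ → trans (sym (hue-sym v w vw)) (sym eq)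
        ; (suc (suc zero)) (suc (suc zero)) ()
        }))

  free⇒good : GoodColouring G
  free⇒good = record { κ = hue ; κ-sym = hue-sym ; not-all-equal = hue-not-all-equal }

module _ {G : Graph (Fin n)} (C : GoodColouring G) where

  edge-colouring : EdgeColouring G
  edge-colouring = record
    { colour     = λ u v _ → κ C u v
    ; colour-sym = λ u v e _ → κ-sym C u v e
    }

  mono-P₃-free : ∀ x → ¬ ColouredEmbedding (monochromatic x P₃) edge-colouring
  mono-P₃-free x m =
    nonadjacent C (λ p → Fin.0≢1+n (injective f p)) (λ e → edge⁻¹ f e)
      (edge f {zero} {suc zero} tt) (edge f {suc zero} {suc (suc zero)} tt)
      (trans (colour-≡ zero (suc zero) tt (edge f tt))
             (sym (colour-≡ (suc zero) (suc (suc zero)) tt (edge f tt))))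
    where
    open ColouredEmbedding m using (colour-≡) renaming (embedding to f)

  mono-K₃-free : ∀ x → ¬ ColouredEmbedding (monochromatic x (complete 3)) edge-colouring
  mono-K₃-free x m =
    proj₂ (not-all-equal C _ _ _ (λ p → Fin.0≢1+n (injective f p))
             (edge f {zero} {suc zero} tt) (edge f {suc zero} {suc (suc zero)} tt)
             (trans (colour-≡ zero (suc zero) tt (edge f tt))
                    (sym (colour-≡ (suc zero) (suc (suc zero)) tt (edge f tt)))))
          (trans (colour-≡ zero (suc (suc zero)) tt (edge f tt))
                 (sym (colour-≡ zero (suc zero) tt (edge f tt))))
    where
    open ColouredEmbedding m using (colour-≡) renaming (embedding to f)

  good⇒free : (MonochromaticP₃K₃ -FreeColouring) edge-colouring
  good⇒free ᵇP₃ = mono-P₃-free blue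
  good⇒free ʳP₃ = mono-P₃-free red
  good⇒free ᵇK₃ = mono-K₃-free blue
  good⇒free ʳK₃ = mono-K₃-free red

-- Graphs without good colouring

-- Backtracking search: a partial colouring is abandoned as soon as its latest edge
-- violates the not-all-equal condition.
module Refutation {k : ℕ} (F : Graph (Fin k)) where

  Partial : Set
  Partial = List (Fin k × Fin k × Colour)

  -- Two edges `u v` and `v w` of colour `x` force `u w` to be an edge of the other colour. A clash
  -- records that `u w` is a non-edge or already has colour `x`.
  Clash : Partial → Fin k → Fin k → Colour → Set
  Clash ρ u v x = ∃[ w ] (u ≢ w × (v , w , x) ∈ˡ ρ × (adj F u w ≡ false ⊎ (u , w , x) ∈ˡ ρ))

  Refuted : List (Fin k × Fin k) → Partial → Set
  Refuted []             ρ = ⊥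
  Refuted ((u , v) ∷ es) ρ = T (adj F u v) × Branch red × Branch blue
    where
    Branch : Colour → Set
    Branch x = Clash ρ u v x ⊎ Clash ρ v u x ⊎ Refuted es ((u , v , x) ∷ (v , u , x) ∷ ρ)

  infix 4 _≟ᵉ_
  _≟ᵉ_ : DecidableEquality (Fin k × Fin k × Colour)
  _≟ᵉ_ = Prod.≡-dec Fin._≟_ (Prod.≡-dec Fin._≟_ _≟ᶜ_)

  open DecMembership _≟ᵉ_ using () renaming (_∈?_ to _∈ˡ?_)

  clash? : ∀ ρ u v x → Dec (Clash ρ u v x)
  clash? ρ u v x = Fin.any? λ w → ¬? (u Fin.≟ w) ×-dec ((v , w , x) ∈ˡ? ρ)
    ×-dec ((adj F u w Bool.≟ false) ⊎-dec ((u , w , x) ∈ˡ? ρ))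

  refuted? : ∀ es ρ → Dec (Refuted es ρ)
  refuted? []             ρ = no λ ()
  refuted? ((u , v) ∷ es) ρ = Bool.T? (adj F u v) ×-dec branch? red ×-dec branch? blue
    where
    branch? : ∀ x → Dec (Clash ρ u v x ⊎ Clash ρ v u x
                         ⊎ Refuted es ((u , v , x) ∷ (v , u , x) ∷ ρ))
    branch? x = clash? ρ u v x ⊎-dec (clash? ρ v u x ⊎-dec refuted? es _)

  -- Each edge appears once, larger end first, so the list is sorted by larger end. All edges among
  -- earlier vertices are coloured before the next vertex enters, which brings clashes forward.
  edges : List (Fin k × Fin k)
  edges = filterᵇ (λ (v , u) → adj F u v ∧ (toℕ u <ᵇ toℕ v))
                  (cartesianProduct (allFin k) (allFin k))

  module _ (C : GoodColouring F) where

    Agrees : Partial → Set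
    Agrees ρ = ∀ {u v x} → (u , v , x) ∈ˡ ρ → T (adj F u v) × κ C u v ≡ x

    no-clash : ∀ {ρ u v x} → Agrees ρ → T (adj F u v) → κ C u v ≡ x → ¬ Clash ρ u v x
    no-clash agrees uv refl (w , u≢w , vw∈ , bad)
      with vw , eq ← agrees vw∈
      with uw , ne ← not-all-equal C _ _ w u≢w uv vw (sym eq)
      with bad
    ... | inj₁ ¬uw = ≡false⇒¬T ¬uw uw
    ... | inj₂ uw∈ = ne (proj₂ (agrees uw∈))

    -- An actual good colouring selects one branch at every edge; the selected branch can never
    -- clash, and the list of edges eventually runs out, where nothing is refuted.
    not-refuted : ∀ es {ρ} → Agrees ρ → ¬ Refuted es ρ
    not-refuted ((u , v) ∷ es) {ρ} agrees (uv , r , b) = pick (κ C u v) refl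
      where
      branch : ∀ {x} → κ C u v ≡ x →
               ¬ (Clash ρ u v x ⊎ Clash ρ v u x ⊎ Refuted es ((u , v , x) ∷ (v , u , x) ∷ ρ))
      branch eq (inj₁ c)        = no-clash agrees uv eq c
      branch eq (inj₂ (inj₁ c)) =
        no-clash agrees (symmetric F uv) (trans (sym (κ-sym C u v uv)) eq) c
      branch eq (inj₂ (inj₂ r)) = not-refuted es
        (λ { (here refl)         → uv , eq
           ; (there (here refl)) → symmetric F uv , trans (sym (κ-sym C u v uv)) eq
           ; (there (there m))   → agrees m }) r

      pick : ∀ x → κ C u v ≡ x → ⊥
      pick red  eq = branch eq r
      pick blue eq = branch eq b

  refute : Refuted edges [] → ¬ GoodColouring F
  refute r C = not-refuted C edges (λ ()) r

open Refutation using (refute; refuted?; edges)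

uncolourable? : (F : Graph (Fin k)) → Dec (Refutation.Refuted F (edges F) [])
uncolourable? F = refuted? F (edges F) []

-- Paths, cycles and butterflies

isZero : Fin k → Bool
isZero i = 0 ≡ᵇ toℕ i

isLast : ∀ k → Fin l → Bool
isLast k i = toℕ i ≡ᵇ k

isEnd : ∀ k → Fin l → Bool
isEnd k i = isZero i ∨ isLast k i

isLast-unique : ∀ k (i j : Fin l) → T (isLast k i) → T (isLast k j) → i ≡ j
isLast-unique k i j p q =
  Fin.toℕ-injective (trans (Nat.≡ᵇ⇒≡ (toℕ i) k p) (sym (Nat.≡ᵇ⇒≡ (toℕ j) k q)))

-- The index counts edges. Growing at zero makes `▹` and `tail` lengthen and shorten the path.
path : ∀ k → Graph (Fin (suc k))
path zero    = complete 1
path (suc k) = isZero ▹ path k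

last-neighbour : ∀ k i → T (isLast (suc k) i) → ∃[ j ] T (adj (path (suc k)) i j)
last-neighbour zero    (suc zero) _ = zero , tt
last-neighbour (suc k) (suc i)    l with j , e ← last-neighbour k i l = suc j , e

some-last : ∀ k → ∃[ i ] T (isLast {suc k} k i)
some-last zero    = zero , tt
some-last (suc k) with i , l ← some-last k = suc i , l

path-adj : ∀ k u v → adj (path k) u v ≡ adj (fromRel {suc k} λ i j → suc (toℕ i) ≡ᵇ toℕ j) u v
path-adj zero    zero          zero          = refl
path-adj (suc k) zero          zero          = refl
path-adj (suc k) zero          (suc zero)    = refl
path-adj (suc k) zero          (suc (suc v)) = refl
path-adj (suc k) (suc zero)    zero          = refl
path-adj (suc k) (suc (suc u)) zero          = refl
path-adj (suc k) (suc u)       (suc v)       = path-adj k u v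

-- Presents a cycle as a path with one further vertex joined to both ends, the form in which cycles
-- are coloured and found.
cycle-adj : ∀ k u v → adj (isEnd k ▹ path k) u v ≡ adj (cycle (2 + k)) u v
cycle-adj k zero    zero    = refl
cycle-adj k zero    (suc v) = sym (Bool.∨-identityʳ _)
cycle-adj k (suc u) zero    = refl
cycle-adj k (suc u) (suc v) =
  trans (path-adj k u v)
        (sym (cong₂ (λ x y → not (does (u Fin.≟ v)) ∧ (x ∨ y))
                    (Bool.∨-identityʳ (suc (toℕ u) ≡ᵇ toℕ v))
                    (Bool.∨-identityʳ (suc (toℕ v) ≡ᵇ toℕ u))))

-- A triangle with a path of length `j` hanging from it. Vertex zero is the free end of that path,
-- or a corner of the triangle when `j` is zero.
lollipop : ∀ j → Graph (Fin (3 + j))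
lollipop zero    = complete 3
lollipop (suc j) = isZero ▹ lollipop j

isZeroOrOne : Fin k → Bool
isZeroOrOne zero    = true
isZeroOrOne (suc i) = isZero i

-- Turns zero into a vertex of a new triangle.
cap : Graph (Fin (suc k)) → Graph (Fin (3 + k))
cap H = isZeroOrOne ▹ isZero ▹ H

lollipop-adj : ∀ j u v → adj (lollipop j) u v ≡
  adj (fromRel {3 + j} λ a b → (suc (toℕ a) ≡ᵇ toℕ b) ∨ ((toℕ a ≡ᵇ j) ∧ (toℕ b ≡ᵇ 2 + j))) u v
lollipop-adj zero zero zero = refl
lollipop-adj zero zero (suc zero) = refl
lollipop-adj zero zero (suc (suc zero)) = refl
lollipop-adj zero (suc zero) zero = refl
lollipop-adj zero (suc zero) (suc zero) = refl
lollipop-adj zero (suc zero) (suc (suc zero)) = refl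
lollipop-adj zero (suc (suc zero)) zero = refl
lollipop-adj zero (suc (suc zero)) (suc zero) = refl
lollipop-adj zero (suc (suc zero)) (suc (suc zero)) = refl
lollipop-adj (suc j) zero zero = refl
lollipop-adj (suc j) zero (suc zero) = refl
lollipop-adj (suc j) zero (suc (suc v)) = sym (Bool.∧-zeroʳ _)
lollipop-adj (suc j) (suc zero) zero = sym (trans (Bool.∨-zeroʳ _) refl)
lollipop-adj (suc j) (suc (suc u)) zero = sym (trans (Bool.∨-identityʳ _) (Bool.∧-zeroʳ _))
lollipop-adj (suc j) (suc u) (suc v) = lollipop-adj j u v

butterfly-adj : ∀ j u v → adj (cap (lollipop j)) u v ≡ adj (butterfly j) u v
butterfly-adj j zero zero = refl
butterfly-adj j zero (suc zero) = refl
butterfly-adj j zero (suc (suc zero)) = refl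
butterfly-adj j zero (suc (suc (suc v))) = sym (Bool.∧-zeroʳ _)
butterfly-adj j (suc zero) zero = refl
butterfly-adj j (suc (suc zero)) zero = sym (Bool.∨-zeroʳ _)
butterfly-adj j (suc (suc (suc u))) zero = sym (trans (Bool.∨-identityʳ _) (Bool.∧-zeroʳ _))
butterfly-adj j (suc zero) (suc zero) = refl
butterfly-adj j (suc zero) (suc (suc zero)) = refl
butterfly-adj j (suc zero) (suc (suc (suc v))) = sym (Bool.∧-zeroʳ _)
butterfly-adj j (suc (suc zero)) (suc zero) = sym (Bool.∨-zeroʳ _)
butterfly-adj j (suc (suc (suc u))) (suc zero) = sym (trans (Bool.∨-identityʳ _) (Bool.∧-zeroʳ _))
butterfly-adj j (suc (suc u)) (suc (suc v)) = lollipop-adj j u v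

alternate : ℕ → Colour → Colour
alternate zero    x = x
alternate (suc k) x = alternate k (opposite x)

alternate-even : ∀ m x → alternate (2 * m) x ≡ x
alternate-even zero    x = refl
alternate-even (suc m) x =
  trans (cong (λ k → alternate k x) (Nat.*-suc 2 m))
        (trans (cong (alternate (2 * m)) (opposite-involutive x)) (alternate-even m x))

-- Vertices at distance two on a path are not adjacent, so consecutive edges have different colours.
last-colour : ∀ k (C : GoodColouring (path (suc k))) i j → T (isLast (suc k) i) →
              T (adj (path (suc k)) i j) → κ C i j ≡ alternate k (κ C zero (suc zero))
last-colour zero    C (suc zero) zero    _ e = κ-sym C (suc zero) zero e
last-colour zero    C (suc zero) (suc zero) _ ()
last-colour (suc k) C (suc (suc i)) (suc j) l e =
  trans (last-colour k (pullback (tail-⊑ (path (suc (suc k)))) C) (suc i) j l e)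
        (cong (alternate k)
              (≢⇒≡opposite λ eq → nonadjacent C {zero} {suc zero} {suc (suc zero)}
                                    (λ ()) (λ ()) tt tt (sym eq)))

-- The two edges at the new vertex differ from the first and the last edge of the
-- path, which agree; so they are equal although their ends are not adjacent.
odd-cycle-uncolourable : ∀ m → ¬ GoodColouring (cycle (3 + 2 * suc m))
odd-cycle-uncolourable m C = go (2 * suc m) (Nat.*-suc 2 m) (alternate-even (suc m)) C
  where
  -- The length is generalised to a variable `k`, so that matching on it exposes the first vertices
  -- while the equation rules out `k` below 2.
  go : ∀ k → k ≡ 2 + 2 * m → (∀ x → alternate k x ≡ x) → ¬ GoodColouring (cycle (3 + k))
  go k@(suc (suc _)) _ even C
    with i , l ← some-last (suc k)
    with j , e ← last-neighbour k i l = at-last i j l e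
    where
    D : GoodColouring (isEnd (suc k) ▹ path (suc k))
    D = pullback (≗⇒⊒ (cycle-adj (suc k))) C

    first : κ D zero (suc zero) ≢ κ D (suc zero) (suc (suc zero))
    first = nonadjacent D (λ ()) (λ ()) tt tt

    at-last : ∀ i j → T (isLast (suc k) i) → T (adj (path (suc k)) i j) → ⊥
    at-last i@(suc (suc _)) j@(suc _) l e =
      nonadjacent D (λ ()) (λ ()) tt l
        (trans (sym (κ-sym D zero (suc zero) tt))
               (trans (≢⇒≡opposite first)
                      (trans (cong opposite (sym same)) (sym (≢⇒≡opposite last)))))
      where
      same : κ D (suc i) (suc j) ≡ κ D (suc zero) (suc (suc zero))
      same = trans (last-colour k (pullback (tail-⊑ (isEnd (suc k) ▹ path (suc k))) D) i j l e)
                   (even _)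

      last : κ D zero (suc i) ≢ κ D (suc i) (suc j)
      last = nonadjacent D (λ ()) not-end l e
        where
        not-end : ¬ T (isEnd (suc k) j)
        not-end l′ = ~⇒≢ (path (suc k)) e (isLast-unique (suc k) i j l l′)

forbidden-uncolourable : {F : Graph (Fin k)} → Forbidden F → ¬ GoodColouring F
forbidden-uncolourable (odd-holeᶠ (suc (suc m)) _) C =
  odd-cycle-uncolourable m (subst (GoodColouring ∘ cycle) (odd m) C)
  where
  odd : ∀ m → 2 * suc (suc m) + 1 ≡ 3 + 2 * suc m
  odd m = trans (Nat.+-comm _ 1) (cong suc (Nat.*-suc 2 (suc m)))
forbidden-uncolourable (odd-holeᶠ (suc zero) (s≤s ()))
forbidden-uncolourable clawᶠ    = refute claw (from-yes (uncolourable? claw))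
forbidden-uncolourable houseᶠ   = refute house (from-yes (uncolourable? house))
forbidden-uncolourable bullᶠ    = refute bull (from-yes (uncolourable? bull))
forbidden-uncolourable gemᶠ     = refute gem (from-yes (uncolourable? gem))
forbidden-uncolourable 4-wheelᶠ = refute 4-wheel (from-yes (uncolourable? 4-wheel))
forbidden-uncolourable kiteᶠ    = refute kite (from-yes (uncolourable? kite))
forbidden-uncolourable X₁ᶠ      = refute X₁ (from-yes (uncolourable? X₁))
forbidden-uncolourable X₂ᶠ      = refute X₂ (from-yes (uncolourable? X₂))
forbidden-uncolourable K₄+lᶠ    = refute K₄+l (from-yes (uncolourable? K₄+l))
forbidden-uncolourable K₅-eᶠ    = refute K₅-e (from-yes (uncolourable? K₅-e))
forbidden-uncolourable K₆ᶠ      = refute (complete 6) (from-yes (uncolourable? (complete 6)))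

-- Good colourings of the component types

redEdges : (R : Graph V) → V → V → Colour
redEdges R u v = if adj R u v then red else blue

module _ (G R : Graph (Fin n)) where

  redEdges-good? : Dec (NotAllEqual G (redEdges R))
  redEdges-good? = Fin.all? λ u → Fin.all? λ v → Fin.all? λ w →
    ¬? (u Fin.≟ w) →-dec (Bool.T? (adj G u v) →-dec (Bool.T? (adj G v w) →-dec
      ((redEdges R u v ≟ᶜ redEdges R v w) →-dec
        (Bool.T? (adj G u w) ×-dec ¬? (redEdges R u w ≟ᶜ redEdges R u v)))))

  redEdges-good : NotAllEqual G (redEdges R) → GoodColouring G
  redEdges-good nae = record
    { κ             = redEdges R
    ; κ-sym         = λ u v _ → cong (λ b → if b then red else blue) (Graph.adj-sym R u v)
    ; not-all-equal = nae
    }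

-- K₅ splits into a red 5-cycle and its complement, a blue 5-cycle; in each, vertices at distance
-- two are joined by an edge of the other.
K₅-good : GoodColouring (complete 5)
K₅-good = redEdges-good (complete 5) (cycle 5) (from-yes (redEdges-good? (complete 5) (cycle 5)))

diamond-good : GoodColouring diamond
diamond-good = redEdges-good diamond R (from-yes (redEdges-good? diamond R))
  where
  R : Graph (Fin 4)
  -- The red edges form a matching. The blue edges form the path 3, 0, 1, 2, whose pairs at distance
  -- two are exactly the red edges.
  R = fromEdges 4 ((0 , 2) ∷ (1 , 3) ∷ [])

-- A walk of two edges through the new vertex has it in the middle (`at-new`) or at the start
-- (`at-old`); one that ends there is reversed.
module _ {H : Graph (Fin k)} (C : GoodColouring H) (b : Fin k → Bool) (c : Fin k → Colour)
  (at-new : ∀ i j → i ≢ j → T (b i) → T (b j) → c i ≡ c j → T (adj H i j) × κ C i j ≢ c i)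
  (at-old : ∀ i j → T (b i) → T (adj H i j) → c i ≡ κ C i j → T (b j) × c j ≢ c i)
  where

  private
    κ′ : Fin (suc k) → Fin (suc k) → Colour
    κ′ zero    zero    = red
    κ′ zero    (suc v) = c v
    κ′ (suc u) zero    = c u
    κ′ (suc u) (suc v) = κ C u v

    κ′-sym : ∀ u v → T (adj (b ▹ H) u v) → κ′ u v ≡ κ′ v u
    κ′-sym zero    (suc v) e = refl
    κ′-sym (suc u) zero    e = refl
    κ′-sym (suc u) (suc v) e = κ-sym C u v e

    κ′-nae : NotAllEqual (b ▹ H) κ′
    κ′-nae zero    (suc i) zero    z≢z _  _  _  = ⊥-elim (z≢z refl)
    κ′-nae zero    (suc i) (suc j) _   bi ij eq = at-old i j bi ij eq
    κ′-nae (suc i) zero    (suc j) i≢j bi bj eq = at-new i j (i≢j ∘ cong suc) bi bj eq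
    κ′-nae (suc i) (suc j) zero    _   ij bj eq
      with ji ← symmetric H ij
      with bi , ne ← at-old j i bj ji (trans (sym eq) (κ-sym C i j ij)) =
      bi , λ e → ne (trans e eq)
    κ′-nae (suc u) (suc v) (suc w) u≢w uv vw eq = not-all-equal C u v w (u≢w ∘ cong suc) uv vw eq

  ▹-good : GoodColouring (b ▹ H)
  ▹-good = record { κ = κ′ ; κ-sym = κ′-sym ; not-all-equal = κ′-nae }

-- When all edges at zero share a colour, a new edge at zero may take the opposite one. This is the
-- invariant for growing paths and lollipops.
TipColour : {H : Graph (Fin (suc k))} → GoodColouring H → Colour → Set
TipColour {H = H} C x = ∀ i → T (adj H zero i) → κ C zero i ≡ x

module _ {H : Graph (Fin (suc k))} (C : GoodColouring H) {x : Colour} (tip : TipColour C x) where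

  pendant-good : GoodColouring (isZero ▹ H)
  pendant-good = ▹-good C isZero (λ _ → opposite x)
    (λ { zero zero 0≢0 _ _ _ → ⊥-elim (0≢0 refl) })
    (λ { zero j _ e eq → ⊥-elim (opposite-≢ x (trans eq (tip j e))) })

  pendant-tip : TipColour pendant-good (opposite x)
  pendant-tip (suc i) _ = refl

lollipop-good : ∀ j → Σ[ C ∈ GoodColouring (lollipop j) ] ∃[ x ] TipColour C x
lollipop-good zero = redEdges-good (complete 3) R (from-yes (redEdges-good? (complete 3) R)) , red
  , λ { (suc zero) _ → refl ; (suc (suc zero)) _ → refl }
  where
  R : Graph (Fin 3)
  -- Both edges at the tip are red, as the invariant requires, and the third is blue.
  R = fromEdges 3 ((0 , 1) ∷ (0 , 2) ∷ [])
lollipop-good (suc j) with C , x , tip ← lollipop-good j =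
  pendant-good C tip , opposite x , pendant-tip C tip

-- Both new edges at the tip take the colour opposite to `x`, and the third edge of the new triangle
-- takes `x`.
cap-good : {H : Graph (Fin (suc k))} (C : GoodColouring H) {x : Colour} → TipColour C x →
           GoodColouring (cap H)
cap-good C {x} tip = ▹-good (pendant-good C tip) _ c
  (λ { zero       zero       i≢j _ _ _  → ⊥-elim (i≢j refl)
     ; zero       (suc zero) _   _ _ eq → ⊥-elim (opposite-≢ x (sym eq))
     ; (suc zero) zero       _   _ _ eq → ⊥-elim (opposite-≢ x eq)
     ; (suc zero) (suc zero) i≢j _ _ _  → ⊥-elim (i≢j refl) })
  (λ { zero       (suc zero) _ _ eq → ⊥-elim (opposite-≢ x (sym eq))
     ; (suc zero) zero       _ _ _  → tt , λ eq → opposite-≢ x (sym eq)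
     ; (suc zero) (suc j)    _ e eq → ⊥-elim (opposite-≢ x (trans eq (tip j e))) })
  where
  c : Fin (suc (suc _)) → Colour
  c zero    = x
  c (suc _) = opposite x

butterfly-good : ∀ j → GoodColouring (butterfly j)
butterfly-good j with C , x , tip ← lollipop-good j =
  pullback (≗⇒⊑ (butterfly-adj j)) (cap-good C tip)

LastColour : ∀ k → GoodColouring (path k) → Colour → Set
LastColour k C y = ∀ i j → T (isLast k i) → T (adj (path k) i j) → κ C i j ≡ y

PathColouring : ℕ → Colour → Colour → Set
PathColouring k x y = Σ[ C ∈ GoodColouring (path k) ] (TipColour C x × LastColour k C y)

path-step : ∀ {k x y} → PathColouring (suc k) x y → PathColouring (suc (suc k)) (opposite x) y
path-step (C , tip , last) = pendant-good C tip , pendant-tip C tip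
  , λ { (suc (suc i)) (suc j) l e → last (suc i) j l e }

-- With an even number of alternating edges, the first and last colours differ. The induction starts
-- from a single red edge, lengthened once.
path-good : ∀ m → PathColouring (2 + 2 * m) blue red
path-good zero    = path-step
  ( redEdges-good (path 1) (path 1) (from-yes (redEdges-good? (path 1) (path 1)))
  , (λ { (suc zero) _ → refl })
  , λ { (suc zero) zero _ _ → refl ; (suc zero) (suc zero) _ () } )
path-good (suc m) = subst (λ k → PathColouring (2 + k) blue red) (sym (Nat.*-suc 2 m))
                          (path-step (path-step (path-good m)))

even-cycle-good : ∀ m → GoodColouring (cycle (2 + (2 + 2 * m)))
even-cycle-good m with C , tip , last ← path-good m =
  pullback (≗⇒⊑ (cycle-adj (2 + 2 * m))) (▹-good C (isEnd (2 + 2 * m)) c new old)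
  where
  c : Fin (suc k) → Colour
  -- The path starts with blue and ends with red, so each closing edge takes the opposite colour.
  -- These two colours differ, as needed at the new vertex, whose neighbours are not adjacent.
  c zero    = red
  c (suc _) = blue

  new : ∀ i j → i ≢ j → T (isEnd (2 + 2 * m) i) → T (isEnd (2 + 2 * m) j) → c i ≡ c j →
        T (adj (path (2 + 2 * m)) i j) × κ C i j ≢ c i
  new zero    zero    i≢j _ _  _  = ⊥-elim (i≢j refl)
  new (suc i) (suc j) i≢j l l′ _  = ⊥-elim (i≢j (isLast-unique (2 + 2 * m) (suc i) (suc j) l l′))

  old : ∀ i j → T (isEnd (2 + 2 * m) i) → T (adj (path (2 + 2 * m)) i j) → c i ≡ κ C i j →
        T (isEnd (2 + 2 * m) j) × c j ≢ c i
  old zero    j _ e eq with () ← trans eq (tip j e)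
  old (suc i) j l e eq with () ← trans eq (last (suc i) j l e)

type-good : {H : Graph V} → ComponentType H → GoodColouring H
type-good (inj₁ f)                                = pullback f K₅-good
type-good (inj₂ (inj₁ f))                         = pullback f diamond-good
type-good (inj₂ (inj₂ (inj₁ (suc (suc m) , _ , f)))) = pullback f
  (subst (GoodColouring ∘ cycle) (sym (trans (Nat.*-suc 2 (suc m)) (cong (2 +_) (Nat.*-suc 2 m))))
         (even-cycle-good m))
type-good (inj₂ (inj₂ (inj₁ (suc zero , s≤s () , f))))
type-good (inj₂ (inj₂ (inj₂ (n , f))))            = pullback f (butterfly-good n)

-- Components

module _ (G : Graph (Fin n)) where

  Linked : Fin n → Fin n → Set
  Linked = Star (Graph._~_ G)

  Linked-sym : ∀ {u v} → Linked u v → Linked v u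
  Linked-sym = reverse (symmetric G)

  -- Union–find: the edges are inserted one by one, each merging two classes.
  representatives-for : (es : List (Fin n × Fin n)) →
    Σ[ rep ∈ (Fin n → Fin n) ] ((∀ x → Linked x (rep x))
      × (∀ u v → (u , v) ∈ˡ es → T (adj G u v) → rep u ≡ rep v))
  representatives-for [] = (λ x → x) , (λ _ → ε) , λ _ _ ()
  representatives-for ((a , b) ∷ es)
    with rep , linked , respects ← representatives-for es
    with Bool.T? (adj G a b)
  ... | no ¬ab = rep , linked , λ
    { u v (here refl) ab → ⊥-elim (¬ab ab) ; u v (there m) uv → respects u v m uv }
  ... | yes ab = merge ∘ rep , linked′ , λ
    { u v (here refl) _ → merged ; u v (there m) uv → cong merge (respects u v m uv) }
    where
    merge : Fin n → Fin n
    merge x = if does (x Fin.≟ rep a) then rep b else x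

    linked′ : ∀ x → Linked x (merge (rep x))
    linked′ x with rep x Fin.≟ rep a
    ... | no  _ = linked x
    ... | yes p = subst (Linked x) p (linked x) ◅◅ Linked-sym (linked a) ◅◅ (ab ◅ linked b)

    merged : merge (rep a) ≡ merge (rep b)
    merged with rep b Fin.≟ rep a
    ... | yes _ = cong (λ d → if d then rep b else rep a) (dec-true (rep a Fin.≟ rep a) refl)
    ... | no  _ = cong (λ d → if d then rep b else rep a) (dec-true (rep a Fin.≟ rep a) refl)

  representatives : Σ[ rep ∈ (Fin n → Fin n) ] ((∀ x → Linked x (rep x))
                      × (∀ u v → T (adj G u v) → rep u ≡ rep v))
  representatives
    with rep , linked , respects ← representatives-for (cartesianProduct (allFin n) (allFin n)) =
    rep , linked , λ u v → respects u v (∈-cartesianProduct⁺ (∈-allFin u) (∈-allFin v))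

  module _ (good : ∀ S → IsComponent G S → GoodColouring (G [ S ])) where

    private
      rep : Fin n → Fin n
      rep = proj₁ representatives

      respects : ∀ u v → T (adj G u v) → rep u ≡ rep v
      respects = proj₂ (proj₂ representatives)

      linked⇒≡ : ∀ {u v} → Linked u v → rep u ≡ rep v
      linked⇒≡ ε       = refl
      linked⇒≡ (e ◅ s) = trans (respects _ _ e) (linked⇒≡ s)

      ≡⇒linked : ∀ {u v} → rep u ≡ rep v → Linked u v
      ≡⇒linked {u} {v} p =
        subst (Linked u) p (proj₁ (proj₂ representatives) u)
        ◅◅ Linked-sym (proj₁ (proj₂ representatives) v)

      class : Fin n → Subset n
      class r = tabulate λ x → does (rep r Fin.≟ rep x)

      ≡⇒∈ : ∀ {r x} → rep r ≡ rep x → x ∈ class r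
      ≡⇒∈ {r} {x} p = lookup⇒[]= x (class r)
        (trans (lookup∘tabulate _ x) (dec-true (rep r Fin.≟ rep x) p))

      ∈⇒≡ : ∀ {r x} → x ∈ class r → rep r ≡ rep x
      ∈⇒≡ {r} {x} m with p ← trans (sym (lookup∘tabulate _ x)) ([]=⇒lookup m)
                    with yes q ← rep r Fin.≟ rep x = q

      class-component : ∀ r → IsComponent G (class r)
      class-component r = r , λ u → mk⇔ (≡⇒linked ∘ ∈⇒≡) (≡⇒∈ ∘ linked⇒≡)

      C : ∀ r → GoodColouring (G [ class r ])
      C r = good (class r) (class-component r)

      self : ∀ u → u ∈ class (rep u)
      self u = ≡⇒∈ (sym (linked⇒≡ (proj₁ (proj₂ representatives) u)))

      -- The colouring is taken at the representative of `u`, since `good` may return different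
      -- colourings for different proofs that the same set is a component. Pairs in different
      -- components, coloured red, are never edges.
      shade : Fin n → Fin n → Colour
      shade u v with v ∈? class (rep u)
      ... | yes m = κ (C (rep u)) (u , self u) (v , m)
      ... | no  _ = red

      shade-≡ : ∀ r {u v} (p : u ∈ class r) (q : v ∈ class r) → rep u ≡ r →
                shade u v ≡ κ (C r) (u , p) (v , q)
      shade-≡ _ {u} {v} p q refl with v ∈? class (rep u)
      ... | yes m = cong₂ (λ a b → κ (C (rep u)) (u , a) (v , b))
                          ([]=-irrelevant (self u) p) ([]=-irrelevant m q)
      ... | no ¬m = ⊥-elim (¬m q)

    glued : GoodColouring G
    glued = record { κ = shade ; κ-sym = shade-sym ; not-all-equal = shade-nae }
      where
      next : ∀ {r u v} → u ∈ class r → T (adj G u v) → v ∈ class r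
      next m e = ≡⇒∈ (trans (∈⇒≡ m) (respects _ _ e))

      shade-sym : ∀ u v → T (adj G u v) → shade u v ≡ shade v u
      shade-sym u v e =
        trans (shade-≡ r p q refl)
              (trans (κ-sym (C r) (u , p) (v , q) e) (sym (shade-≡ r q p (sym (respects u v e)))))
        where
        r = rep u
        p = self u
        q = next p e

      shade-nae : NotAllEqual G shade
      shade-nae u v w u≢w uv vw eq
        with uw , ne ← not-all-equal (C (rep u)) (u , self u) (v , next (self u) uv)
                         (w , next (next (self u) uv) vw) (u≢w ∘ cong proj₁) uv vw
                         (trans (sym (shade-≡ (rep u) _ _ refl))
                                (trans eq (shade-≡ (rep u) _ _ (sym (respects u v uv))))) =
        uw , λ e → ne (trans (sym (shade-≡ (rep u) _ _ refl))
                             (trans e (shade-≡ (rep u) _ _ refl)))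

-- Connected graphs without forbidden subgraphs

even-or-odd : ∀ n → ∃[ m ] (n ≡ 2 * m ⊎ n ≡ 2 * m + 1)
even-or-odd zero = 0 , inj₁ refl
even-or-odd (suc n) with even-or-odd n
... | m , inj₁ p = m , inj₂ (trans (cong suc p) (Nat.+-comm 1 (2 * m)))
... | m , inj₂ p = suc m , inj₁ (trans (cong suc (trans p (Nat.+-comm (2 * m) 1)))
                                      (sym (Nat.*-suc 2 m)))

half-≥2 : ∀ {k m} → 4 + k ≡ 2 * m ⊎ 4 + k ≡ 2 * m + 1 → 2 ≤ m
half-≥2 {m = suc (suc m)} _ = s≤s (s≤s z≤n)
half-≥2 {m = zero}        (inj₁ ())
half-≥2 {m = zero}        (inj₂ ())
half-≥2 {m = suc zero}    (inj₁ ())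
half-≥2 {m = suc zero}    (inj₂ ())

module Connected {V : Set} (fin : Finite V) (G : Graph V)
                 (linked : ∀ u v → Star (Graph._~_ G) u v)
                 (free : ∀ {k} {F : Graph (Fin k)} → Forbidden F → ¬ (F ⊑ G)) where

  open Finite fin
  open Graph G using (_~_)

  _~?_ : ∀ u v → Dec (u ~ v)
  u ~? v = Bool.T? (adj G u v)

  Image : {H : Graph (Fin k)} → H ⊑ G → V → Set
  Image f y = ∃[ i ] to f i ≡ y

  image? : {H : Graph (Fin k)} (f : H ⊑ G) → ∀ y → Dec (Image f y)
  image? f y = Fin.any? λ i → to f i ≟ y

  ClosedAt : {H : Graph (Fin k)} → H ⊑ G → Fin k → Set
  ClosedAt f i = ∀ y → to f i ~ y → Image f y

  -- By connectedness an image closed under neighbours contains every vertex, and then `f` can be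
  -- inverted.
  cover : {H : Graph (Fin (suc k))} (f : H ⊑ G) → (∀ i → ClosedAt f i) → G ⊑ H
  cover {k} {H} f closed = record
    { to        = proj₁ ∘ index
    ; injective = λ {u} {v} p →
        trans (sym (proj₂ (index u))) (trans (cong (to f) p) (proj₂ (index v)))
    ; adj-≡     = λ u v →
        trans (sym (adj-≡ f _ _)) (cong₂ (adj G) (proj₂ (index u)) (proj₂ (index v)))
    }
    where
    follow : ∀ {u v} → Star _~_ u v → Image f u → Image f v
    follow ε       m          = m
    follow (e ◅ s) (i , refl) = follow s (closed i _ e)

    index : ∀ v → Image f v
    index v = follow (linked (to f zero) v) (zero , refl)

  -- Converts a vertex outside the image into an attachment pattern, a Boolean vector of the kind
  -- over which the exhaustive checks quantify.
  neighbourhood : {H : Graph (Fin k)} (f : H ⊑ G) → ∀ {y} → ¬ Image f y →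
    Σ[ p ∈ Vec Bool k ] ((∀ i → lookup p i ≡ adj G y (to f i))
      × Σ[ g ∈ lookup p ▹ H ⊑ G ] (to g zero ≡ y × ∀ i → to g (suc i) ≡ to f i))
  neighbourhood {k} {H} f {y} y∉f =
    p , p≗ , extend _ f y (λ i e → y∉f (i , e)) (λ i → sym (p≗ i)) , refl , λ _ → refl
    where
    p : Vec Bool k
    p = tabulate λ i → adj G y (to f i)
    p≗ : ∀ i → lookup p i ≡ adj G y (to f i)
    p≗ = lookup∘tabulate _

  avoids-small : All (λ (_ , F) → ¬ (F ⊑ G)) small
  avoids-small = All.map (λ φ → free φ) small-forbidden

  ¬contains : ∀ {Fs} → All (λ (_ , F) → ¬ (F ⊑ G)) Fs → ¬ Contains Fs G
  ¬contains = All¬⇒¬Any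

  saturated-closed : ∀ {Fs} {H : Graph (Fin k)} → Saturated Fs H → ¬ Contains Fs G →
                     (f : H ⊑ G) → ∀ i → ClosedAt f i
  saturated-closed sat avoids f i y e with image? f y
  ... | yes m = m
  ... | no ¬m with neighbourhood f ¬m
  ...   | p , p≗ , g , _ with sat p
  ...     | inj₁ isolated = ⊥-elim (≡false⇒¬T (trans (sym (p≗ i)) (isolated i)) (symmetric G e))
  ...     | inj₂ bad      = ⊥-elim (avoids (Contains-mono g bad))

  no-claw : ∀ {c x y z} → c ~ x → c ~ y → c ~ z → x ≢ y → x ≢ z → y ≢ z →
            ¬ x ~ y → ¬ x ~ z → y ~ z
  no-claw {c} {x} {y} {z} cx cy cz x≢y x≢z y≢z ¬xy ¬xz with y ~? z
  ... | yes yz = yz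
  ... | no ¬yz = ⊥-elim (free clawᶠ embedding)
    where
    one : tail (tail claw) ⊑ G
    one = extend _ (extend (tail (tail (tail claw))) nothing z (λ ()) (λ ())) y
      (λ { 0F p → y≢z (sym p) }) (λ { 0F → ¬T⇒≡false ¬yz })
    two : tail claw ⊑ G
    two = extend _ one x
      (λ { 0F p → x≢y (sym p) ; 1F p → x≢z (sym p) })
      (λ { 0F → ¬T⇒≡false ¬xy ; 1F → ¬T⇒≡false ¬xz })
    embedding : claw ⊑ G
    embedding = extend _ two c
      (λ { 0F p → ~⇒≢ G cx (sym p) ; 1F p → ~⇒≢ G cy (sym p) ; 2F p → ~⇒≢ G cz (sym p) })
      (λ { 0F → T⇒≡true cx ; 1F → T⇒≡true cy ; 2F → T⇒≡true cz })

  -- Connected graphs with neither diamond nor K₄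

  module Sparse (no-diamond : ¬ (diamond ⊑ G)) (no-K₄ : ¬ (complete 4 ⊑ G)) where

    avoids : ¬ Contains triangle-small G
    avoids = ¬contains (no-diamond ∷ no-K₄ ∷ avoids-small)

    one-attachment : (f : complete 3 ⊑ G) → ∀ {y} → ¬ Image f y → ∀ i j →
                     to f i ~ y → to f j ~ y → i ≡ j
    one-attachment f ¬m i j iy jy with neighbourhood f ¬m
    ... | p , p≗ , g , _ with triangle-neighbour p
    ...   | inj₁ q   = q i j (subst T (sym (p≗ i)) (symmetric G iy))
                             (subst T (sym (p≗ j)) (symmetric G jy))
    ...   | inj₂ bad = ⊥-elim (avoids (Contains-mono g bad))

    one-exit : (f : complete 3 ⊑ G) → ∀ {y z} → ¬ Image f y → ¬ Image f z → ∀ i j →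
               to f i ~ y → to f j ~ z → i ≡ j
    one-exit f {y} {z} ¬y ¬z i j iy jz with y ≟ z
    ... | yes refl = one-attachment f ¬y i j iy jz
    ... | no y≢z with neighbourhood f ¬y
    ...   | p , p≗ , g , g0 , g≗
          with neighbourhood g {z} (λ { (zero , e)  → y≢z (trans (sym g0) e)
                                      ; (suc m , e) → ¬z (m , trans (sym (g≗ m)) e) })
    ...     | q , q≗ , h , _ with triangle-neighbours p q
    ...       | inj₁ r   = r i j (subst T (sym (p≗ i)) (symmetric G iy))
                             (subst T (sym (trans (q≗ (suc j)) (cong (adj G z) (g≗ j))))
                                      (symmetric G jz))
    ...       | inj₂ bad = ⊥-elim (avoids (Contains-mono h bad))

    lollipop⊑butterfly : ∀ j → lollipop j ⊑ butterfly j
    lollipop⊑butterfly j =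
      ⊑-trans (⊑-trans (tail-⊑ (isZero ▹ lollipop j)) (tail-⊑ (cap (lollipop j))))
              (≗⇒⊒ (butterfly-adj j))

    -- The condition that `▹-mono` imposes when a pendant vertex is attached at the tips of both
    -- graphs.
    tip-only : {H : Graph (Fin (suc k))} {K : Graph (Fin (suc l))} (g : H ⊑ K) → to g zero ≡ zero →
               ∀ i → isZero (to g i) ≡ isZero i
    tip-only g g0 zero rewrite g0 = refl
    tip-only g g0 (suc i) with to g (suc i) in e
    ... | suc _ = refl
    ... | zero with () ← injective g {suc i} {zero} (trans e (sym g0))

    -- All vertices but the tip zero are closed, so a new neighbour y of the tip
    -- extends the tail; two new neighbours y and z form a triangle with the tip.
    grow : ∀ d {k j} {H : Graph (Fin (2 + k))} (f : H ⊑ G) (g : H ⊑ lollipop j) →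
           to g zero ≡ zero → T (adj H zero 1F) → (∀ i → ClosedAt f (suc i)) →
           size ≤ k + d → ∃[ n ] (G ⊑ butterfly n)
    -- Out of fuel: `f` places `2 + k` distinct vertices, while `size` is at most `k`.
    grow zero {k} f _ _ _ _ size≤ =
      ⊥-elim (Nat.1+n≰n (Nat.≤-trans (Nat.n≤1+n _) (Nat.≤-trans (bound (injective f))
                (subst (size ≤_) (Nat.+-identityʳ k) size≤))))
    grow (suc d) {k} {j} {H} f g g0 t~p closed size≤
      with any? (λ y → (to f zero ~? y) ×-dec ¬? (image? f y))
    ... | no none = j , ⊑-trans (cover f closed′) (⊑-trans g (lollipop⊑butterfly j))
      where
      closed′ : ∀ i → ClosedAt f i
      closed′ (suc i) = closed i
      closed′ zero y e with image? f y
      ... | yes m = m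
      ... | no ¬m = ⊥-elim (none (y , e , ¬m))
    ... | yes (y , ty , y∉) = continue (any? λ z → (t ~? z) ×-dec ¬? (image? f z) ×-dec ¬? (z ≟ y))
      where
      t p : V
      t = to f zero
      p = to f 1F

      t~p′ : t ~ p
      t~p′ = edge f t~p

      ¬~old : ∀ {w} → ¬ Image f w → ∀ i → ¬ to f (suc i) ~ w
      ¬~old w∉ i e = w∉ (closed i _ e)

      f₁ : isZero ▹ H ⊑ G
      f₁ = extend _ f y (λ i e → y∉ (i , e)) λ
        { zero → T⇒≡true (symmetric G ty) ; (suc i) → ¬T⇒≡false (¬~old y∉ i ∘ symmetric G) }

      g₁ : isZero ▹ H ⊑ lollipop (suc j)
      g₁ = ▹-mono g (tip-only g g0)

      continue : Dec (∃[ z ] (t ~ z × ¬ Image f z × z ≢ y)) → ∃[ n ] (G ⊑ butterfly n)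
      continue (no none) = grow d f₁ g₁ refl tt closed₁ (subst (size ≤_) (Nat.+-suc k d) size≤)
        where
        closed₁ : ∀ i → ClosedAt f₁ (suc i)
        closed₁ (suc i) w e with m , q ← closed i w e = suc m , q
        closed₁ zero    w e with image? f w
        ... | yes (m , q) = suc m , q
        ... | no w∉ with w ≟ y
        ...   | yes q  = zero , sym q
        ...   | no w≢y = ⊥-elim (none (w , e , w∉ , w≢y))
      continue (yes (z , tz , z∉ , z≢y)) =
        j , ⊑-trans (cover f₂ closed₂) 
            (⊑-trans (▹-mono g₁ λ { zero → refl ; (suc i) → tip-only g g0 i })
                     (≗⇒⊒ (butterfly-adj j)))
        where
        -- All neighbours of `p` lie in the image, so `p` is adjacent to neither `y` nor `z`;
        -- without this edge, `t` would be the centre of a claw.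
        yz : y ~ z
        yz = no-claw t~p′ ty tz (λ e → y∉ (1F , e)) (λ e → z∉ (1F , e)) (z≢y ∘ sym)
                     (¬~old y∉ zero) (¬~old z∉ zero)

        f₂ : cap H ⊑ G
        f₂ = extend _ f₁ z (λ { zero e → z≢y (sym e) ; (suc i) e → z∉ (i , e) }) λ
          { zero          → T⇒≡true (symmetric G yz)
          ; (suc zero)    → T⇒≡true (symmetric G tz)
          ; (suc (suc i)) → ¬T⇒≡false (¬~old z∉ i ∘ symmetric G) }

        tri : complete 3 ⊑ G
        tri = triangle ty tz yz

        p∉tri : ¬ Image tri p
        p∉tri (0F , e) = ~⇒≢ G t~p′ e
        p∉tri (1F , e) = y∉ (1F , sym e)
        p∉tri (2F , e) = z∉ (1F , sym e)

        ∉tri : ∀ {w} → ¬ Image f₂ w → ¬ Image tri w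
        ∉tri w∉ (0F , e) = w∉ (2F , e)
        ∉tri w∉ (1F , e) = w∉ (1F , e)
        ∉tri w∉ (2F , e) = w∉ (0F , e)

        -- The triangle `t`, `y`, `z` already has the outside neighbour `p` at `t`, so `y` and `z`
        -- have none.
        no-exit : ∀ {w} → ¬ Image f₂ w → ∀ i → ¬ to tri (suc i) ~ w
        no-exit w∉ i e with () ← one-exit tri p∉tri (∉tri w∉) zero (suc i) t~p′ e

        -- A further neighbour `w` of `t` would, with `p` and `y`, form a claw or be adjacent to
        -- `y`, an exit just excluded.
        no-branch : ∀ {w} → ¬ Image f₂ w → ¬ t ~ w
        no-branch {w} w∉ tw = no-exit w∉ zero (no-claw t~p′ ty tw
          (λ e → y∉ (1F , e)) (λ e → w∉ (3F , e)) (λ e → w∉ (1F , e))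
          (¬~old y∉ zero) (¬~old (λ (m , e) → w∉ (suc (suc m) , e)) zero))

        closed₂ : ∀ i → ClosedAt f₂ i
        closed₂ i w e with image? f₂ w
        ... | yes m = m
        closed₂ 0F w e | no w∉ = ⊥-elim (no-exit w∉ 1F e)
        closed₂ 1F w e | no w∉ = ⊥-elim (no-exit w∉ 0F e)
        closed₂ 2F w e | no w∉ = ⊥-elim (no-branch w∉ e)
        closed₂ (suc (suc (suc i))) w e | no w∉ with m , q ← closed i w e =
          ⊥-elim (w∉ (suc (suc m) , q))

    triangle-type : complete 3 ⊑ G → ComponentType G
    triangle-type f with Fin.any? (λ i → any? λ y → (to f i ~? y) ×-dec ¬? (image? f y))
    ... | no none = inj₁ (⊑-trans (cover f closed) (triangle {u = 0F} {1F} {2F} tt tt tt))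
      where
      closed : ∀ i → ClosedAt f i
      closed i y e with image? f y
      ... | yes m = m
      ... | no ¬m = ⊥-elim (none (i , y , e , ¬m))
    ... | yes (i , y , iy , y∉) =
      inj₂ (inj₂ (inj₂ (grow size f′ ⊑-refl refl tt closed (Nat.n≤1+n size))))
      where
      -- Relabels the triangle so that its vertex with an outside neighbour becomes the tip zero.
      turn : ∀ i → Σ[ r ∈ complete 3 ⊑ complete 3 ] to r zero ≡ i
      turn 0F = ⊑-refl , refl
      turn 1F = triangle {u = 1F} {0F} {2F} tt tt tt , refl
      turn 2F = triangle {u = 2F} {0F} {1F} tt tt tt , refl

      f′ : complete 3 ⊑ G
      f′ = ⊑-trans (proj₁ (turn i)) f

      exit : to f′ zero ~ y
      exit = subst (λ v → to f v ~ y) (sym (proj₂ (turn i))) iy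

      closed : ∀ i → ClosedAt f′ (suc i)
      closed j w e with image? f′ w
      ... | yes m = m
      ... | no w∉ with () ← one-exit f′ (λ (m , q) → y∉ (_ , q)) w∉ zero (suc j) exit e

  Branching : V → Set
  Branching u = ∃[ y ] ∃[ z ] (u ~ y × u ~ z × y ≢ z)

  branching? : ∀ u → Dec (Branching u)
  branching? u = any? λ y → any? λ z → (u ~? y) ×-dec (u ~? z) ×-dec ¬? (y ≟ z)

  -- Connected triangle-free graphs of minimum degree two

  module TriangleFree (no-K₃ : ¬ (complete 3 ⊑ G)) (branching : ∀ u → Branching u) where

    -- Without triangles the neighbours of `c` are pairwise non-adjacent, so three of them would
    -- form a claw.
    two-neighbours : ∀ {c x y z} → c ~ x → c ~ y → x ≢ y → c ~ z → z ≡ x ⊎ z ≡ y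
    two-neighbours {c} {x} {y} {z} cx cy x≢y cz with z ≟ x | z ≟ y
    ... | yes e  | _      = inj₁ e
    ... | no _   | yes e  = inj₂ e
    ... | no z≢x | no z≢y = ⊥-elim (¬adjacent cy cz (no-claw cx cy cz x≢y (z≢x ∘ sym) (z≢y ∘ sym)
                                                       (¬adjacent cx cy) (¬adjacent cx cz)))
      where
      ¬adjacent : ∀ {u v} → c ~ u → c ~ v → ¬ u ~ v
      ¬adjacent cu cv uv = no-K₃ (triangle cu cv uv)

    full : {H : Graph (Fin k)} (f : H ⊑ G) → ∀ {i} j j′ → T (adj H i j) → T (adj H i j′) → j ≢ j′ →
           ClosedAt f i
    full f j j′ e e′ j≢j′ y iy with two-neighbours (edge f e) (edge f e′) (j≢j′ ∘ injective f) iy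
    ... | inj₁ p = j , sym p
    ... | inj₂ p = j′ , sym p

    -- The cycle has `4 + k` vertices, so an odd length is at least 5 and gives a forbidden odd
    -- hole.
    close-cycle : ∀ k → (isEnd (2 + k) ▹ path (2 + k)) ⊑ G → G ⊑ (isEnd (2 + k) ▹ path (2 + k)) →
                  ∃[ m ] (2 ≤ m × G ⊑ cycle (2 * m))
    close-cycle k f g with even-or-odd (4 + k)
    ... | m , inj₁ e = m , half-≥2 (inj₁ e)
                     , subst (λ n → G ⊑ cycle n) e (⊑-trans g (≗⇒⊒ (cycle-adj (2 + k))))
    ... | m , inj₂ e = ⊥-elim (free (odd-holeᶠ m (half-≥2 (inj₂ e)))
                                (subst (λ n → cycle n ⊑ G) e (⊑-trans (≗⇒⊑ (cycle-adj (2 + k))) f)))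

    -- The path is continued at zero by a second neighbour `y` of that end. Inner vertices are
    -- closed and hence not adjacent to `y`, so only the last vertex matters: adjacency closes a
    -- cycle, non-adjacency gives a longer induced path. The fuel `d` bounds the number of
    -- extensions.
    walk : ∀ d k (f : path (2 + k) ⊑ G) → (∀ i → ¬ T (isEnd (2 + k) i) → ClosedAt f i) →
           size ≤ k + d → ∃[ m ] (2 ≤ m × G ⊑ cycle (2 * m))
    walk zero k f _ size≤ =
      ⊥-elim (Nat.m+1+n≰m k {2} (Nat.≤-trans
        (subst (_≤ size) (Nat.+-comm 3 k) (bound (injective f)))
        (subst (size ≤_) (Nat.+-identityʳ k) size≤)))
    walk (suc d) k f closed size≤ = step (fresh (branching (to f zero)))
      where
      fresh : Branching (to f zero) → ∃[ y ] (to f zero ~ y × y ≢ to f 1F)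
      fresh (a , b , xa , xb , a≢b) with a ≟ to f 1F
      ... | yes refl = b , xb , a≢b ∘ sym
      ... | no a≢    = a , xa , a≢

      step : ∃[ y ] (to f zero ~ y × y ≢ to f 1F) → ∃[ m ] (2 ≤ m × G ⊑ cycle (2 * m))
      step (y , xy , y≢) = continue (some-last (2 + k))
        where
        y∉ : ¬ Image f y
        y∉ (zero        , e) = ~⇒≢ G xy e
        y∉ (suc zero    , e) = y≢ (sym e)
        y∉ (suc (suc i) , refl) with () ← edge⁻¹ f xy

        ¬~inner : ∀ i → ¬ T (isEnd (2 + k) i) → ¬ y ~ to f i
        ¬~inner i inner e = y∉ (closed i inner y (symmetric G e))

        continue : ∃[ l ] T (isLast {3 + k} (2 + k) l) → ∃[ m ] (2 ≤ m × G ⊑ cycle (2 * m))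
        continue (suc l , last) with y ~? to f (suc l)
        ... | yes yl = close-cycle k f′ (cover f′ closed′)
          where
          f′ : isEnd (2 + k) ▹ path (2 + k) ⊑ G
          f′ = extend _ f y (λ i e → y∉ (i , e)) eq
            where
            unique : ∀ {i} → T (isLast (2 + k) (suc i)) → suc i ≡ suc l
            unique {i} last′ = isLast-unique (2 + k) (suc i) (suc l) last′ last

            eq : ∀ i → adj G y (to f i) ≡ isEnd (2 + k) i
            eq zero = T⇒≡true (symmetric G xy)
            eq (suc i) with Bool.T? (isLast (2 + k) (suc i))
            ... | yes last′ = trans (T⇒≡true (subst (λ v → y ~ to f v) (sym (unique last′)) yl))
                                    (sym (T⇒≡true last′))
            ... | no ¬last = trans (¬T⇒≡false (¬~inner (suc i) ¬last)) (sym (¬T⇒≡false ¬last))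

          closed′ : ∀ i → ClosedAt f′ i
          closed′ zero          = full f′ {0F} 1F (suc (suc l)) tt last λ ()
          closed′ (suc zero)    = full f′ 0F 2F tt tt λ ()
          closed′ (suc (suc i)) with Bool.T? (isLast (2 + k) (suc i))
          ... | yes last′ with j , e ← last-neighbour (suc k) (suc i) last′ =
            full f′ 0F (suc j) last′ e λ ()
          ... | no ¬last = λ w e → let m , q = closed (suc i) ¬last w e in suc m , q
        ... | no ¬yl = walk d (suc k) f′ closed′ (subst (size ≤_) (Nat.+-suc k d) size≤)
          where
          f′ : path (3 + k) ⊑ G
          f′ = extend _ f y (λ i e → y∉ (i , e)) λ
            { zero → T⇒≡true (symmetric G xy) ; (suc i) → ¬T⇒≡false (away i) }
            where
            away : ∀ i → ¬ y ~ to f (suc i)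
            away i with Bool.T? (isLast (2 + k) (suc i))
            ... | yes last′ = subst (λ v → ¬ y ~ to f v)
              (sym (isLast-unique (2 + k) (suc i) (suc l) last′ last)) ¬yl
            ... | no ¬last  = ¬~inner (suc i) ¬last

          closed′ : ∀ i → ¬ T (isEnd (3 + k) i) → ClosedAt f′ i
          closed′ zero          ¬end = ⊥-elim (¬end tt)
          closed′ (suc zero)    _    = full f′ 0F 2F tt tt λ ()
          closed′ (suc (suc i)) ¬end = λ w e → let m , q = closed (suc i) ¬end w e in suc m , q

    even-cycle : V → ∃[ m ] (2 ≤ m × G ⊑ cycle (2 * m))
    even-cycle r with a , b , ra , rb , a≢b ← branching r =
      walk size 0 f (λ { 0F ¬end → ⊥-elim (¬end tt) ; 1F _ → full f {1F} 0F 2F tt tt (λ ())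
                       ; 2F ¬end → ⊥-elim (¬end tt) }) Nat.≤-refl
      where
      rb-path : path 1 ⊑ G
      rb-path = extend _ (vertex b) r (λ { 0F e → ~⇒≢ G rb (sym e) }) (λ { 0F → T⇒≡true rb })

      f : path 2 ⊑ G
      f = extend _ rb-path a
        (λ { 0F e → ~⇒≢ G ra e ; 1F e → a≢b (sym e) })
        (λ { 0F → T⇒≡true (symmetric G ra) ; 1F → ¬T⇒≡false λ ab → no-K₃ (triangle ra rb ab) })

  triangle-free-type : ¬ (diamond ⊑ G) → ¬ (complete 4 ⊑ G) → ¬ (complete 3 ⊑ G) →
                       V → ComponentType G
  triangle-free-type no-diamond no-K₄ no-K₃ r with any? (λ u → ¬? (branching? u))
  ... | no ¬leaf = inj₂ (inj₂ (inj₁ (TriangleFree.even-cycle no-K₃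
                     (λ u → decidable-stable (branching? u) (λ ¬b → ¬leaf (u , ¬b))) r)))
  ... | yes (u , leaf) with any? (u ~?_)
  ...   | no isolated = inj₁ (⊑-trans (cover (vertex u) λ { 0F y e → ⊥-elim (isolated (y , e)) })
                                      (vertex 0F))
  -- The leaf `u` is the closed vertex and `y` the tip. A path is a lollipop lacking one corner of
  -- its triangle, so the edge is placed inside `lollipop 0` and the same growth applies.
  ...   | yes (y , uy) = inj₂ (inj₂ (inj₂ (Sparse.grow no-diamond no-K₄ size {j = 0}
    (pair (symmetric G uy)) (pair {u = 0F} {1F} tt) refl tt closed Nat.≤-refl)))
    where
    closed : ∀ i → ClosedAt (pair (symmetric G uy)) (suc i)
    closed 0F w e with w ≟ y
    ... | yes p  = 0F , sym p
    ... | no w≢y = ⊥-elim (leaf (w , y , e , uy , w≢y))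

  component-type : V → ComponentType G
  component-type r with embeds? fin diamond G | embeds? fin (complete 5) G
                      | embeds? fin (complete 4) G | embeds? fin (complete 3) G
  ... | yes f | _ | _ | _ =
    inj₂ (inj₁ (cover f (saturated-closed diamond-saturated (¬contains avoids-small) f)))
  ... | no _ | yes f | _ | _ =
    inj₁ (cover f (saturated-closed K₅-saturated (¬contains avoids-small) f))
  ... | no _ | no no-K₅ | yes f | _ =
    inj₁ (⊑-trans (cover f (saturated-closed K₄-saturated (¬contains (no-K₅ ∷ avoids-small)) f))
                  (from-yes (embeds? Fin-finite (complete 4) (complete 5))))
  ... | no no-diamond | no _ | no no-K₄ | yes f = Sparse.triangle-type no-diamond no-K₄ f
  ... | no no-diamond | no _ | no no-K₄ | no no-K₃ = triangle-free-type no-diamond no-K₄ no-K₃ r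

-- Components as connected graphs in their own right

module _ {S : Subset n} where

  ∈-≡ : {u v : Σ[ v ∈ Fin n ] v ∈ S} → proj₁ u ≡ proj₁ v → u ≡ v
  ∈-≡ {u , p} {_ , q} refl = cong (u ,_) ([]=-irrelevant p q)

  subset-finite : Finite (Σ[ v ∈ Fin n ] v ∈ S)
  subset-finite = record
    { _≟_   = λ u v → map′ ∈-≡ (cong proj₁) (proj₁ u Fin.≟ proj₁ v)
    ; any?  = λ P? → map′ (λ (v , p , h) → (v , p) , h) (λ ((v , p) , h) → v , p , h)
                          (Fin.any? λ v → decide P? v)
    ; size  = n
    ; bound = λ inj → Fin.injective⇒≤ (inj ∘ ∈-≡)
    }
    where
    decide : {P : Σ[ v ∈ Fin n ] v ∈ S → Set} → (∀ v → Dec (P v)) →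
             ∀ v → Dec (Σ[ p ∈ v ∈ S ] P (v , p))
    decide {P} P? v with v ∈? S
    ... | no ¬p = no (¬p ∘ proj₁)
    ... | yes p =
      map′ (p ,_) (λ (q , h) → subst (λ p → P (v , p)) ([]=-irrelevant q p) h) (P? (v , p))

module _ {G : Graph (Fin n)} {S : Subset n} (component : IsComponent G S) where

  private
    r = proj₁ component
    reachable = proj₂ component

  ∈⇒Linked : ∀ {u} → u ∈ S → Linked G r u
  ∈⇒Linked {u} = Equivalence.to (reachable u)

  Linked⇒∈ : ∀ {u} → Linked G r u → u ∈ S
  Linked⇒∈ {u} = Equivalence.from (reachable u)

  -- Every vertex on a walk that starts in `S` is reachable from the root and so lies in `S`. At the
  -- end of the walk two membership proofs meet, which are equal by irrelevance.
  restrict : ∀ {u v} (p : u ∈ S) (q : v ∈ S) →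
             Linked G u v → Star (Graph._~_ (G [ S ])) (u , p) (v , q)
  restrict p q ε = subst (Star _ (_ , p)) (∈-≡ refl) ε
  restrict p q (e ◅ s) = e ◅ restrict (Linked⇒∈ (∈⇒Linked p ◅◅ (e ◅ ε))) q s

  component-linked : ∀ u v → Star (Graph._~_ (G [ S ])) u v
  component-linked (u , p) (v , q) =
    restrict p q (Linked-sym G (∈⇒Linked p) ◅◅ ∈⇒Linked q)

  induced : G [ S ] ⊑ G
  induced = record { to = proj₁ ; injective = ∈-≡ ; adj-≡ = λ _ _ → refl }

  free-component : (Forbidden -Free) G → ComponentType (G [ S ])
  free-component free =
    Connected.component-type subset-finite (G [ S ]) component-linked
      (λ φ f → free φ (⊑-trans f induced)) (r , Linked⇒∈ ε)

-- The cycle of implications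

module _ (G : Graph (Fin n)) where

  colouring⇒free : HasFreeColouring MonochromaticP₃K₃ G → (Forbidden -Free) G
  colouring⇒free (c , free) φ f = forbidden-uncolourable φ (pullback f (free⇒good c free))

  free⇒components : (Forbidden -Free) G → AllComponents ComponentType G
  free⇒components free S component = free-component component free

  components⇒colouring : AllComponents ComponentType G → HasFreeColouring MonochromaticP₃K₃ G
  components⇒colouring types = edge-colouring C , good⇒free C
    where
    C : GoodColouring G
    C = glued G λ S component → type-good (types S component)

proposition24 : ∀ {n : ℕ} (G : Graph (Fin n)) →
    (HasFreeColouring MonochromaticP₃K₃ G ⇔ AllComponents ComponentType G)
    × (AllComponents ComponentType G ⇔ (Forbidden -Free) G)
proposition24 G =
    mk⇔ (free⇒components G ∘ colouring⇒free G) (components⇒colouring G)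
  , mk⇔ (colouring⇒free G ∘ components⇒colouring G) (free⇒components G)
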